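{- Let $p$ be an odd prime, let $G=\langle a,b,c \mid a^p=b^p=c^p=1,\ [a,b]=c,\ [c,a]=[c,b]=1\rangle$, and let $S=\{a^i,b^i\mid 1\leq i\leq p-1\}$. Then the Cayley graph $\mathrm{Cay}(G,S)$ is a $2$-distance-transitive normal Cayley graph that is neither distance-transitive nor $2$-arc-transitive.
   Context: All graphs are finite, simple and undirected; $V(\Gamma)$ and $\mathrm{Aut}(\Gamma)$ denote the vertex set and full automorphism group of a graph $\Gamma$. Here $[x,y]=x^{ -1}y^{ -1}xy$. For a finite group $G$ and $S\subseteq G\setminus\{1\}$ with $S=S^{ -1}$, the Cayley graph $\mathrm{Cay}(G,S)$ has vertex set $G$, with $g,h$ adjacent if and only if $hg^{ -1}\in S$. For $g\in G$ let $R(g)$ be the permutation $x\mapsto xg$ of $G$, and $R(G)=\{R(g)\mid g\in G\}$, a regular subgroup of $\mathrm{Aut}(\mathrm{Cay}(G,S))$. The Cayley graph $\Gamma=\mathrm{Cay}(G,S)$ is called normal if $R(G)$ is a normal subgroup of $\mathrm{Aut}(\Gamma)$. Let $d(u,v)$ be the usual graph distance. A graph $\Gamma$ is distance-transitive if for any vertices $u,v,x,y$ with $d(u,v)=d(x,y)$ there is $g\in\mathrm{Aut}(\Gamma)$ with $(u,v)^g=(x,y)$. A graph $\Gamma$ is $t$-distance-transitive if for each $1\le i\le t$ the group $\mathrm{Aut}(\Gamma)$ is transitive on the ordered pairs $(u,v)$ of vertices with $d(u,v)=i$. An $s$-arc of $\Gamma$ is a sequence $v_0,v_1,\dots,v_s$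 of vertices such that $v_{i-1},v_i$ are adjacent for $1\le i\le s$ and $v_{i-1}\neq v_{i+1}$ for $1\le i\le s-1$. $\Gamma$ is $s$-arc-transitive if it has at least one $s$-arc and $\mathrm{Aut}(\Gamma)$ is transitive on the set of $s$-arcs of $\Gamma$. -}

module Defs where

open import Algebra.Bundles using (RawGroup; Group)
import Algebra.Definitions.RawMonoid as RawMonoidDefinitions
import Algebra.Properties.Group as GroupProperties
open import Data.Fin.Base using (Fin; toℕ; fromℕ<; combine; remQuot)
open import Data.Fin.Properties using (toℕ<n; toℕ-fromℕ<; toℕ-injective; remQuot-combine; combine-remQuot)
open import Data.Integer.Base as ℤ using (ℤ; +_; 0ℤ; 1ℤ)
open import Data.Integer.Divisibility.Signed using (divides; ∣⇒∣ᵤ)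
import Data.Integer.Properties as ℤₚ
open import Data.Integer.Tactic.RingSolver using (solve-∀)
open import Data.Nat.Base as ℕ using (ℕ; zero; suc; _∸_; _≤_; _<_; NonZero; s≤s; z≤n)
import Data.Nat.Divisibility as ℕ
open import Data.Nat.DivMod using (m%n<n; m≡m%n+[m/n]*n; _%_; _/_)
import Data.Nat.Properties as ℕₚ
open import Data.Product.Base using (∃; ∃-syntax; _×_; _,_; proj₁; proj₂; map₂)
open import Data.Sum.Base as Sum using (_⊎_; inj₁; inj₂)
open import Data.Vec.Functional using (Vector)
open import Function.Base using (_∘_)
open import Function.Bundles using (Inverse; _⇔_; mk⇔; Equivalence)
import Function.Construct.Composition as Composition
import Function.Construct.Identity as Identity
import Function.Construct.Symmetry as Symmetry
open import Level using (0ℓ)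
open import Relation.Binary.Bundles using (Setoid)
open import Relation.Binary.Core using (Rel)
open import Relation.Binary.Definitions using (Symmetric; Irreflexive; _Respects_; _Respects₂_)
open import Relation.Binary.PropositionalEquality as ≡ using (_≡_)
import Relation.Binary.Reasoning.Setoid as SetoidReasoning
open import Relation.Nullary.Negation using (¬_)
open import Relation.Unary using (Pred; _∈_; _∉_)

IsFinite : Setoid 0ℓ 0ℓ → Set
IsFinite S = ∃[ n ] Inverse (≡.setoid (Fin n)) S

record Graph : Set₁ where
  field
    vertices : Setoid 0ℓ 0ℓ
    finite   : IsFinite vertices
  open Setoid vertices public renaming (Carrier to V)
  field
    Adj        : Rel V 0ℓ
    Adj-resp-≈ : Adj Respects₂ _≈_
    Adj-sym    : Symmetric Adj
    Adj-irrefl : Irreflexive _≈_ Adj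

module _ (Γ : Graph) where
  open Graph Γ

  record Automorphism : Set where
    field
      perm : Inverse vertices vertices
    open Inverse perm public
    field
      Adj-⇔ : ∀ {u v} → Adj u v ⇔ Adj (to u) (to v)

  infixl 9 _^ᵃ_
  _^ᵃ_ : V → Automorphism → V
  v ^ᵃ φ = Automorphism.to φ v

  -- Permutations act on the right, so φ ∙ ψ is φ followed by ψ.
  Aut : Group 0ℓ 0ℓ
  Aut = record
    { Carrier = Automorphism
    ; _≈_     = λ φ ψ → ∀ v → v ^ᵃ φ ≈ v ^ᵃ ψ
    ; _∙_     = _∙_
    ; ε       = record { perm = Identity.inverse vertices ; Adj-⇔ = Identity.⇔-id _ }
    ; _⁻¹     = _⁻¹
    ; isGroup = record
      { isMonoid = record
        { isSemigroup = record
          { isMagma = record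
            { isEquivalence = record
              { refl  = λ v → refl
              ; sym   = λ φ≈ψ v → sym (φ≈ψ v)
              ; trans = λ φ≈ψ ψ≈χ v → trans (φ≈ψ v) (ψ≈χ v)
              }
            ; ∙-cong = λ {φ} {φ′} {ψ} {ψ′} φ≈φ′ ψ≈ψ′ v →
                trans (Automorphism.to-cong ψ (φ≈φ′ v)) (ψ≈ψ′ (v ^ᵃ φ′))
            }
          ; assoc = λ φ ψ χ v → refl
          }
        ; identity = (λ φ v → refl) , (λ φ v → refl)
        }
      ; inverse = (λ φ v → Automorphism.strictlyInverseˡ φ v)
                , (λ φ v → Automorphism.strictlyInverseʳ φ v)
      ; ⁻¹-cong = λ {φ} {ψ} φ≈ψ v →
          let open Automorphism in
          inverseʳ φ (trans (sym (strictlyInverseˡ ψ v)) (sym (φ≈ψ (from ψ v))))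
      }
    }
    where
    _∙_ : Automorphism → Automorphism → Automorphism
    φ ∙ ψ = record
      { perm  = Composition.inverse (Automorphism.perm φ) (Automorphism.perm ψ)
      ; Adj-⇔ = Composition._⇔-∘_ (Automorphism.Adj-⇔ ψ) (Automorphism.Adj-⇔ φ)
      }
    _⁻¹ : Automorphism → Automorphism
    φ ⁻¹ = record
      { perm  = Symmetry.inverse perm
      ; Adj-⇔ = λ {u} {v} → mk⇔
          (λ uv → Equivalence.from Adj-⇔
            (proj₁ Adj-resp-≈ (sym (strictlyInverseˡ v))
              (proj₂ Adj-resp-≈ (sym (strictlyInverseˡ u)) uv)))
          (λ uv → proj₁ Adj-resp-≈ (strictlyInverseˡ v)
            (proj₂ Adj-resp-≈ (strictlyInverseˡ u) (Equivalence.to Adj-⇔ uv)))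
      }
      where open Automorphism φ

  data Walk : V → V → ℕ → Set where
    here : ∀ {u v} → u ≈ v → Walk u v 0
    step : ∀ {u v w n} → Adj u v → Walk v w n → Walk u w (suc n)

  IsDistance : V → V → ℕ → Set
  IsDistance u v n = Walk u v n × (∀ {m} → Walk u v m → n ≤ m)

  -- d(u,v) = d(x,y), where the distance between vertices in different
  -- components is ∞.
  SameDistance : V → V → V → V → Set
  SameDistance u v x y = ∀ n → IsDistance u v n ⇔ IsDistance x y n

  DistanceTransitive : Set
  DistanceTransitive = ∀ u v x y → SameDistance u v x y →
    ∃[ φ ] (u ^ᵃ φ ≈ x × v ^ᵃ φ ≈ y)

  t-DistanceTransitive : ℕ → Set
  t-DistanceTransitive t = ∀ i → 1 ≤ i → i ≤ t →
    ∀ u v x y → IsDistance u v i → IsDistance x y i →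
    ∃[ φ ] (u ^ᵃ φ ≈ x × v ^ᵃ φ ≈ y)

  record IsArc (s : ℕ) (v : Vector V (suc s)) : Set where
    field
      adjacent      : ∀ i j → toℕ j ≡ 1 ℕ.+ toℕ i → Adj (v i) (v j)
      nonBacktracks : ∀ i j → toℕ j ≡ 2 ℕ.+ toℕ i → ¬ (v i ≈ v j)

  s-ArcTransitive : ℕ → Set
  s-ArcTransitive s =
    ∃ (IsArc s) ×
    (∀ v w → IsArc s v → IsArc s w → ∃[ φ ] (∀ i → v i ^ᵃ φ ≈ w i))

record IsNormalSubgroup (G : Group 0ℓ 0ℓ) (H : Pred (Group.Carrier G) 0ℓ) : Set where
  open Group G
  field
    resp      : H Respects _≈_
    ε∈        : ε ∈ H
    ∙-closed  : ∀ {x y} → x ∈ H → y ∈ H → x ∙ y ∈ H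
    ⁻¹-closed : ∀ {x} → x ∈ H → x ⁻¹ ∈ H
    normal    : ∀ g {x} → x ∈ H → g ⁻¹ ∙ x ∙ g ∈ H

record FiniteGroup : Set₁ where
  field
    group  : Group 0ℓ 0ℓ
    finite : IsFinite (Group.setoid group)
  open Group group public

record ConnectionSet (G : FiniteGroup) : Set₁ where
  open FiniteGroup G
  field
    S         : Pred Carrier 0ℓ
    resp      : S Respects _≈_
    ε∉        : ε ∉ S
    ⁻¹-closed : ∀ {x} → x ∈ S → x ⁻¹ ∈ S

module _ (G : FiniteGroup) (C : ConnectionSet G) where
  open FiniteGroup G
  open ConnectionSet C
  open GroupProperties group

  Cay : Graph
  Cay = record
    { vertices   = setoid
    ; finite     = finite
    ; Adj        = λ g h → h ∙ g ⁻¹ ∈ S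
    ; Adj-resp-≈ = (λ h≈h′ → resp (∙-congʳ h≈h′))
                 , (λ g≈g′ → resp (∙-congˡ (⁻¹-cong g≈g′)))
    ; Adj-sym    = λ {g} {h} hg⁻¹ → resp (⁻¹-anti-homo-// h g) (⁻¹-closed hg⁻¹)
    ; Adj-irrefl = λ {g} {h} g≈h hg⁻¹ → ε∉ (resp (x≈y⇒x∙y⁻¹≈ε (sym g≈h)) hg⁻¹)
    }

  R : Carrier → Automorphism Cay
  R g = record
    { perm = record
      { to        = _∙ g
      ; from      = _∙ g ⁻¹
      ; to-cong   = ∙-congʳ
      ; from-cong = ∙-congʳ
      ; inverse   = (λ {x} y≈ → trans (∙-congʳ y≈) (//-rightDividesˡ g x))
                  , (λ {x} y≈ → trans (∙-congʳ y≈) (//-rightDividesʳ g x))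
      }
    ; Adj-⇔ = λ {u} {v} → mk⇔ (resp (sym (cancels u v))) (resp (cancels u v))
    }
    where
    open SetoidReasoning setoid
    cancels : ∀ u v → (v ∙ g) ∙ (u ∙ g) ⁻¹ ≈ v ∙ u ⁻¹
    cancels u v = begin
      (v ∙ g) ∙ (u ∙ g) ⁻¹      ≈⟨ ∙-congˡ (⁻¹-anti-homo-∙ u g) ⟩
      (v ∙ g) ∙ (g ⁻¹ ∙ u ⁻¹)   ≈⟨ assoc (v ∙ g) (g ⁻¹) (u ⁻¹) ⟨
      ((v ∙ g) ∙ g ⁻¹) ∙ u ⁻¹   ≈⟨ ∙-congʳ (//-rightDividesʳ g v) ⟩
      v ∙ u ⁻¹                  ∎

  R[G] : Pred (Automorphism Cay) 0ℓ
  R[G] φ = ∃[ g ] Group._≈_ (Aut Cay) φ (R g)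

  IsNormalCayley : Set
  IsNormalCayley = IsNormalSubgroup (Aut Cay) R[G]

module _ (G : RawGroup 0ℓ 0ℓ) where
  open RawGroup G

  power : Carrier → ℕ → Carrier
  power x n = RawMonoidDefinitions._×_ rawMonoid n x

  commutator : Carrier → Carrier → Carrier
  commutator x y = x ⁻¹ ∙ y ⁻¹ ∙ x ∙ y

infix  8 _⁻¹
infixl 7 _∙_
data Word (X : Set) : Set where
  gen : X → Word X
  ε   : Word X
  _∙_ : Word X → Word X → Word X
  _⁻¹ : Word X → Word X

Word-rawGroup : Set → RawGroup 0ℓ 0ℓ
Word-rawGroup X = record { Carrier = Word X ; _≈_ = _≡_ ; _∙_ = _∙_ ; ε = ε ; _⁻¹ = _⁻¹ }

infixr 9 _^_
_^_ : ∀ {X} → Word X → ℕ → Word X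
_^_ {X} = power (Word-rawGroup X)

[_,_] : ∀ {X} → Word X → Word X → Word X
[_,_] {X} = commutator (Word-rawGroup X)

-- ⟨ X | _≐_ ⟩: words modulo the least congruence containing the group laws and
-- the given relations.
module Presentation {X : Set} (_≐_ : Rel (Word X) 0ℓ) where
  infix 4 _≈_
  data _≈_ : Rel (Word X) 0ℓ where
    relation  : ∀ {u v} → u ≐ v → u ≈ v
    refl      : ∀ {u} → u ≈ u
    sym       : ∀ {u v} → u ≈ v → v ≈ u
    trans     : ∀ {u v w} → u ≈ v → v ≈ w → u ≈ w
    ∙-cong    : ∀ {u u′ v v′} → u ≈ u′ → v ≈ v′ → u ∙ v ≈ u′ ∙ v′
    ⁻¹-cong   : ∀ {u v} → u ≈ v → u ⁻¹ ≈ v ⁻¹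
    assoc     : ∀ u v w → (u ∙ v) ∙ w ≈ u ∙ (v ∙ w)
    identityˡ : ∀ u → ε ∙ u ≈ u
    identityʳ : ∀ u → u ∙ ε ≈ u
    inverseˡ  : ∀ u → u ⁻¹ ∙ u ≈ ε
    inverseʳ  : ∀ u → u ∙ u ⁻¹ ≈ ε

  presentedGroup : Group 0ℓ 0ℓ
  presentedGroup = record
    { Carrier = Word X
    ; _≈_     = _≈_
    ; _∙_     = _∙_
    ; ε       = ε
    ; _⁻¹     = _⁻¹
    ; isGroup = record
      { isMonoid = record
        { isSemigroup = record
          { isMagma = record
            { isEquivalence = record { refl = refl ; sym = sym ; trans = trans }
            ; ∙-cong = ∙-cong
            }
          ; assoc = assoc
          }
        ; identity = identityˡ , identityʳ
        }
      ; inverse = inverseˡ , inverseʳ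
      ; ⁻¹-cong = ⁻¹-cong
      }
    }

data Generator : Set where
  A B C : Generator

a b c : Word Generator
a = gen A
b = gen B
c = gen C

infix 4 _⊢_≐_
data _⊢_≐_ (p : ℕ) : Rel (Word Generator) 0ℓ where
  aᵖ≐1    : p ⊢ a ^ p ≐ ε
  bᵖ≐1    : p ⊢ b ^ p ≐ ε
  cᵖ≐1    : p ⊢ c ^ p ≐ ε
  [a,b]≐c : p ⊢ [ a , b ] ≐ c
  [c,a]≐1 : p ⊢ [ c , a ] ≐ ε
  [c,b]≐1 : p ⊢ [ c , b ] ≐ ε

-- G is the group with the presentation above.  The lemmas establish that G is
-- finite and that S is inverse-closed without the identity: words are evaluated
-- in the Heisenberg group over ℤ modulo p, and each word is brought to the form
-- aⁱ bʲ cᵏ.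

module Heisenberg (p : ℕ) .{{p≢0 : NonZero p}} where
  open Presentation (p ⊢_≐_) public
  open Group presentedGroup using (setoid; ∙-congˡ; ∙-congʳ)
  open GroupProperties presentedGroup
  module ≈ = SetoidReasoning setoid

  infix 4 _≡ₚ_
  record _≡ₚ_ (x y : ℤ) : Set where
    constructor congruent
    field
      quotient : ℤ
      equality : x ≡ y ℤ.+ quotient ℤ.* + p

  ≡⇒≡ₚ : ∀ {x y} → x ≡ y → x ≡ₚ y
  ≡⇒≡ₚ {x} ≡.refl = congruent 0ℤ (lemma x (+ p))
    where
    lemma : ∀ x p → x ≡ x ℤ.+ 0ℤ ℤ.* p
    lemma = solve-∀

  ≡ₚ-sym : ∀ {x y} → x ≡ₚ y → y ≡ₚ x
  ≡ₚ-sym {y = y} (congruent q ≡.refl) = congruent (ℤ.- q) (lemma y q (+ p))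
    where
    lemma : ∀ y q p → y ≡ y ℤ.+ q ℤ.* p ℤ.+ ℤ.- q ℤ.* p
    lemma = solve-∀

  ≡ₚ-trans : ∀ {x y z} → x ≡ₚ y → y ≡ₚ z → x ≡ₚ z
  ≡ₚ-trans {z = z} (congruent q ≡.refl) (congruent r ≡.refl) = congruent (q ℤ.+ r) (lemma z q r (+ p))
    where
    lemma : ∀ z q r p → z ℤ.+ r ℤ.* p ℤ.+ q ℤ.* p ≡ z ℤ.+ (q ℤ.+ r) ℤ.* p
    lemma = solve-∀

  +-congₚ : ∀ {x x′ y y′} → x ≡ₚ x′ → y ≡ₚ y′ → x ℤ.+ y ≡ₚ x′ ℤ.+ y′
  +-congₚ {x′ = x} {y′ = y} (congruent q ≡.refl) (congruent r ≡.refl) = congruent (q ℤ.+ r) (lemma x y q r (+ p))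
    where
    lemma : ∀ x y q r p → (x ℤ.+ q ℤ.* p) ℤ.+ (y ℤ.+ r ℤ.* p) ≡ x ℤ.+ y ℤ.+ (q ℤ.+ r) ℤ.* p
    lemma = solve-∀

  *-congₚ : ∀ {x x′ y y′} → x ≡ₚ x′ → y ≡ₚ y′ → x ℤ.* y ≡ₚ x′ ℤ.* y′
  *-congₚ {x′ = x} {y′ = y} (congruent q ≡.refl) (congruent r ≡.refl) =
    congruent (x ℤ.* r ℤ.+ q ℤ.* y ℤ.+ q ℤ.* r ℤ.* + p) (lemma x y q r (+ p))
    where
    lemma : ∀ x y q r p → (x ℤ.+ q ℤ.* p) ℤ.* (y ℤ.+ r ℤ.* p) ≡
      x ℤ.* y ℤ.+ (x ℤ.* r ℤ.+ q ℤ.* y ℤ.+ q ℤ.* r ℤ.* p) ℤ.* p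
    lemma = solve-∀

  neg-congₚ : ∀ {x x′} → x ≡ₚ x′ → ℤ.- x ≡ₚ ℤ.- x′
  neg-congₚ {x′ = x} (congruent q ≡.refl) = congruent (ℤ.- q) (lemma x q (+ p))
    where
    lemma : ∀ x q p → ℤ.- (x ℤ.+ q ℤ.* p) ≡ ℤ.- x ℤ.+ ℤ.- q ℤ.* p
    lemma = solve-∀

  ≡ₚ⇒≡ : ∀ {i j} → i < p → j < p → + i ≡ₚ + j → i ≡ j
  ≡ₚ⇒≡ {i} {j} i<p j<p (congruent q i≡) = ℤₚ.+-injective (ℤₚ.i-j≡0⇒i≡j (+ i) (+ j) i-j≡0)
    where
    cancel : ∀ j q p → j ℤ.+ q ℤ.* p ℤ.- j ≡ q ℤ.* p
    cancel = solve-∀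
    p∣ : p ℕ.∣ ℤ.∣ + i ℤ.- + j ∣
    p∣ = ∣⇒∣ᵤ (divides q (≡.trans (≡.cong (ℤ._- + j) i≡) (cancel (+ j) q (+ p))))
    bound : ℤ.∣ + i ℤ.- + j ∣ < p
    bound = ℕₚ.≤-<-trans
      (≡.subst (λ k → ℤ.∣ k ∣ ≤ i ℕ.⊔ j) (≡.sym (ℤₚ.m-n≡m⊖n i j)) (ℤₚ.∣m⊝n∣≤m⊔n i j))
      (ℕₚ.⊔-pres-<m i<p j<p)
    i-j≡0 : + i ℤ.- + j ≡ 0ℤ
    i-j≡0 = ℤₚ.∣i∣≡0⇒i≡0 (small p∣ bound)
      where
      small : ∀ {n} → p ℕ.∣ n → n < p → n ≡ 0
      small {zero}  _   _   = ≡.refl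
      small {suc n} p∣n n<p with () ← ℕₚ.<⇒≱ n<p (ℕ.∣⇒≤ p∣n)

  Triple : Set
  Triple = ℤ × ℤ × ℤ

  -- (x , y , z) stands for aˣ bʸ cᶻ; note that b a = a b c⁻¹.
  eval : Word Generator → Triple
  eval (gen A) = 1ℤ , 0ℤ , 0ℤ
  eval (gen B) = 0ℤ , 1ℤ , 0ℤ
  eval (gen C) = 0ℤ , 0ℤ , 1ℤ
  eval ε       = 0ℤ , 0ℤ , 0ℤ
  eval (u ∙ v) = let x , y , z = eval u ; x′ , y′ , z′ = eval v in
    x ℤ.+ x′ , y ℤ.+ y′ , z ℤ.+ z′ ℤ.+ ℤ.- (y ℤ.* x′)
  eval (u ⁻¹)  = let x , y , z = eval u in ℤ.- x , ℤ.- y , ℤ.- z ℤ.+ ℤ.- (y ℤ.* x)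

  infix 4 _≋_
  _≋_ : Rel Triple 0ℓ
  (x , y , z) ≋ (x′ , y′ , z′) = x ≡ₚ x′ × y ≡ₚ y′ × z ≡ₚ z′

  ≡⇒≋ : ∀ {s t} → s ≡ t → s ≋ t
  ≡⇒≋ ≡.refl = ≡⇒≡ₚ ≡.refl , ≡⇒≡ₚ ≡.refl , ≡⇒≡ₚ ≡.refl

  triple : ∀ {x y z x′ y′ z′ : ℤ} → x ≡ x′ → y ≡ y′ → z ≡ z′ → (x , y , z) ≡ (x′ , y′ , z′)
  triple ≡.refl ≡.refl ≡.refl = ≡.refl

  eval-aⁿ : ∀ n → eval (a ^ n) ≡ (+ n , 0ℤ , 0ℤ)
  eval-aⁿ zero = ≡.refl
  eval-aⁿ (suc n) rewrite eval-aⁿ n = ≡.refl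

  eval-bⁿ : ∀ n → eval (b ^ n) ≡ (0ℤ , + n , 0ℤ)
  eval-bⁿ zero = ≡.refl
  eval-bⁿ (suc n) rewrite eval-bⁿ n = ≡.refl

  eval-cⁿ : ∀ n → eval (c ^ n) ≡ (0ℤ , 0ℤ , + n)
  eval-cⁿ zero = ≡.refl
  eval-cⁿ (suc n) rewrite eval-cⁿ n = triple ≡.refl ≡.refl (ℤₚ.+-identityʳ (+ suc n))

  p≡ₚ0 : + p ≡ₚ 0ℤ
  p≡ₚ0 = congruent 1ℤ (lemma (+ p))
    where
    lemma : ∀ p → p ≡ 0ℤ ℤ.+ 1ℤ ℤ.* p
    lemma = solve-∀

  0≡ₚ0 : 0ℤ ≡ₚ 0ℤ
  0≡ₚ0 = ≡⇒≡ₚ ≡.refl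

  eval-relation : ∀ {u v} → p ⊢ u ≐ v → eval u ≋ eval v
  eval-relation aᵖ≐1 rewrite eval-aⁿ p = p≡ₚ0 , 0≡ₚ0 , 0≡ₚ0
  eval-relation bᵖ≐1 rewrite eval-bⁿ p = 0≡ₚ0 , p≡ₚ0 , 0≡ₚ0
  eval-relation cᵖ≐1 rewrite eval-cⁿ p = 0≡ₚ0 , 0≡ₚ0 , p≡ₚ0
  eval-relation [a,b]≐c = ≡⇒≋ ≡.refl
  eval-relation [c,a]≐1 = ≡⇒≋ ≡.refl
  eval-relation [c,b]≐1 = ≡⇒≋ ≡.refl

  eval-cong : ∀ {u v} → u ≈ v → eval u ≋ eval v
  eval-cong (relation r) = eval-relation r
  eval-cong refl = ≡⇒≋ ≡.refl
  eval-cong (sym e) = let x , y , z = eval-cong e in ≡ₚ-sym x , ≡ₚ-sym y , ≡ₚ-sym z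
  eval-cong (trans e f) =
    let x , y , z = eval-cong e ; x′ , y′ , z′ = eval-cong f in
    ≡ₚ-trans x x′ , ≡ₚ-trans y y′ , ≡ₚ-trans z z′
  eval-cong (∙-cong e f) =
    let x , y , z = eval-cong e ; x′ , y′ , z′ = eval-cong f in
    +-congₚ x x′ , +-congₚ y y′ , +-congₚ (+-congₚ z z′) (neg-congₚ (*-congₚ y x′))
  eval-cong (⁻¹-cong e) =
    let x , y , z = eval-cong e in
    neg-congₚ x , neg-congₚ y , +-congₚ (neg-congₚ z) (neg-congₚ (*-congₚ y x))
  eval-cong (assoc u v w) =
    let x , y , z = eval u ; x′ , y′ , z′ = eval v ; x″ , y″ , z″ = eval w in
    ≡⇒≋ (triple (ℤₚ.+-assoc x x′ x″) (ℤₚ.+-assoc y y′ y″) (lemma y z x′ y′ z′ x″ z″))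
    where
    lemma : ∀ y z x′ y′ z′ x″ z″ →
      (z ℤ.+ z′ ℤ.+ ℤ.- (y ℤ.* x′)) ℤ.+ z″ ℤ.+ ℤ.- ((y ℤ.+ y′) ℤ.* x″) ≡
      z ℤ.+ (z′ ℤ.+ z″ ℤ.+ ℤ.- (y′ ℤ.* x″)) ℤ.+ ℤ.- (y ℤ.* (x′ ℤ.+ x″))
    lemma = solve-∀
  eval-cong (identityˡ u) =
    let x , y , z = eval u in
    ≡⇒≋ (triple (ℤₚ.+-identityˡ x) (ℤₚ.+-identityˡ y) (lemma x z))
    where
    lemma : ∀ x z → 0ℤ ℤ.+ z ℤ.+ ℤ.- (0ℤ ℤ.* x) ≡ z
    lemma = solve-∀
  eval-cong (identityʳ u) =
    let x , y , z = eval u in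
    ≡⇒≋ (triple (ℤₚ.+-identityʳ x) (ℤₚ.+-identityʳ y) (lemma y z))
    where
    lemma : ∀ y z → z ℤ.+ 0ℤ ℤ.+ ℤ.- (y ℤ.* 0ℤ) ≡ z
    lemma = solve-∀
  eval-cong (inverseˡ u) =
    let x , y , z = eval u in
    ≡⇒≋ (triple (ℤₚ.+-inverseˡ x) (ℤₚ.+-inverseˡ y) (lemma x y z))
    where
    lemma : ∀ x y z → ℤ.- z ℤ.+ ℤ.- (y ℤ.* x) ℤ.+ z ℤ.+ ℤ.- (ℤ.- y ℤ.* x) ≡ 0ℤ
    lemma = solve-∀
  eval-cong (inverseʳ u) =
    let x , y , z = eval u in
    ≡⇒≋ (triple (ℤₚ.+-inverseʳ x) (ℤₚ.+-inverseʳ y) (lemma x y z))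
    where
    lemma : ∀ x y z → z ℤ.+ (ℤ.- z ℤ.+ ℤ.- (y ℤ.* x)) ℤ.+ ℤ.- (y ℤ.* ℤ.- x) ≡ 0ℤ
    lemma = solve-∀

  nf : ℕ → ℕ → ℕ → Word Generator
  nf i j k = a ^ i ∙ b ^ j ∙ c ^ k

  eval-nf : ∀ i j k → eval (nf i j k) ≡ (+ i , + j , + k)
  eval-nf i j k rewrite eval-aⁿ i | eval-bⁿ j | eval-cⁿ k =
    triple (lemma₁ (+ i)) (lemma₂ (+ j)) (lemma₃ (+ j) (+ k))
    where
    lemma₁ : ∀ i → i ℤ.+ 0ℤ ℤ.+ 0ℤ ≡ i
    lemma₁ = solve-∀
    lemma₂ : ∀ j → 0ℤ ℤ.+ j ℤ.+ 0ℤ ≡ j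
    lemma₂ = solve-∀
    lemma₃ : ∀ j k → 0ℤ ℤ.+ k ℤ.+ ℤ.- ((0ℤ ℤ.+ j) ℤ.* 0ℤ) ≡ k
    lemma₃ = solve-∀

  ^-congˡ : ∀ n {x y} → x ≈ y → x ^ n ≈ y ^ n
  ^-congˡ zero    x≈y = refl
  ^-congˡ (suc n) x≈y = ∙-cong x≈y (^-congˡ n x≈y)

  ^-homo-+ : ∀ x m n → x ^ (m ℕ.+ n) ≈ x ^ m ∙ x ^ n
  ^-homo-+ x zero    n = sym (identityˡ (x ^ n))
  ^-homo-+ x (suc m) n = trans (∙-congˡ (^-homo-+ x m n)) (sym (assoc x (x ^ m) (x ^ n)))

  ^-assoc : ∀ x m n → (x ^ n) ^ m ≈ x ^ (m ℕ.* n)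
  ^-assoc x zero    n = refl
  ^-assoc x (suc m) n = trans (∙-congˡ (^-assoc x m n)) (sym (^-homo-+ x n (m ℕ.* n)))

  xᵖ≈ε : ∀ g → gen g ^ p ≈ ε
  xᵖ≈ε A = relation aᵖ≐1
  xᵖ≈ε B = relation bᵖ≐1
  xᵖ≈ε C = relation cᵖ≐1

  ε^n≈ε : ∀ n → ε ^ n ≈ ε
  ε^n≈ε zero    = refl
  ε^n≈ε (suc n) = trans (identityˡ _) (ε^n≈ε n)

  ^-reduce : ∀ g n → gen g ^ n ≈ gen g ^ (n % p)
  ^-reduce g n = ≈.begin
    x ^ n                             ≈.≡⟨ ≡.cong (x ^_) (m≡m%n+[m/n]*n n p) ⟩
    x ^ (n % p ℕ.+ n / p ℕ.* p)       ≈.≈⟨ ^-homo-+ x (n % p) (n / p ℕ.* p) ⟩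
    x ^ (n % p) ∙ x ^ (n / p ℕ.* p)   ≈.≈⟨ ∙-congˡ (^-assoc x (n / p) p) ⟨
    x ^ (n % p) ∙ (x ^ p) ^ (n / p)   ≈.≈⟨ ∙-congˡ (^-congˡ (n / p) (xᵖ≈ε g)) ⟩
    x ^ (n % p) ∙ ε ^ (n / p)         ≈.≈⟨ ∙-congˡ (ε^n≈ε (n / p)) ⟩
    x ^ (n % p) ∙ ε                   ≈.≈⟨ identityʳ _ ⟩
    x ^ (n % p)                       ≈.∎
    where x = gen g

  ^-inverse : ∀ g n → n ≤ p → (gen g ^ n) ⁻¹ ≈ gen g ^ (p ∸ n)
  ^-inverse g n n≤p = sym (inverseʳ-unique _ _ (≈.begin
    x ^ n ∙ x ^ (p ∸ n)   ≈.≈⟨ ^-homo-+ x n (p ∸ n) ⟨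
    x ^ (n ℕ.+ (p ∸ n))   ≈.≡⟨ ≡.cong (x ^_) (ℕₚ.m+[n∸m]≡n n≤p) ⟩
    x ^ p                 ≈.≈⟨ xᵖ≈ε g ⟩
    ε                     ≈.∎))
    where x = gen g

  gen-inverse : ∀ g → gen g ⁻¹ ≈ gen g ^ (p ∸ 1)
  gen-inverse g = trans (⁻¹-cong (sym (identityʳ (gen g))))
    (^-inverse g 1 (ℕₚ.n≢0⇒n>0 (ℕ.≢-nonZero⁻¹ p)))

  commutator-swap : ∀ x y → x ∙ y ≈ y ∙ x ∙ [ x , y ]
  commutator-swap x y = sym (≈.begin
    y ∙ x ∙ (x ⁻¹ ∙ y ⁻¹ ∙ x ∙ y)     ≈.≈⟨ ∙-congˡ (assoc (x ⁻¹ ∙ y ⁻¹) x y) ⟩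
    y ∙ x ∙ (x ⁻¹ ∙ y ⁻¹ ∙ (x ∙ y))   ≈.≈⟨ ∙-congˡ (∙-congʳ (⁻¹-anti-homo-∙ y x)) ⟨
    y ∙ x ∙ ((y ∙ x) ⁻¹ ∙ (x ∙ y))    ≈.≈⟨ \\-leftDividesˡ (y ∙ x) (x ∙ y) ⟩
    x ∙ y                             ≈.∎)

  ca≈ac : c ∙ a ≈ a ∙ c
  ca≈ac = trans (commutator-swap c a) (trans (∙-congˡ (relation [c,a]≐1)) (identityʳ _))

  cb≈bc : c ∙ b ≈ b ∙ c
  cb≈bc = trans (commutator-swap c b) (trans (∙-congˡ (relation [c,b]≐1)) (identityʳ _))

  commutes-^ : ∀ {x y} → x ∙ y ≈ y ∙ x → ∀ n → x ∙ y ^ n ≈ y ^ n ∙ x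
  commutes-^ xy≈yx zero = trans (identityʳ _) (sym (identityˡ _))
  commutes-^ {x} {y} xy≈yx (suc n) = ≈.begin
    x ∙ (y ∙ y ^ n)   ≈.≈⟨ assoc x y (y ^ n) ⟨
    x ∙ y ∙ y ^ n     ≈.≈⟨ ∙-congʳ xy≈yx ⟩
    y ∙ x ∙ y ^ n     ≈.≈⟨ assoc y x (y ^ n) ⟩
    y ∙ (x ∙ y ^ n)   ≈.≈⟨ ∙-congˡ (commutes-^ xy≈yx n) ⟩
    y ∙ (y ^ n ∙ x)   ≈.≈⟨ assoc y (y ^ n) x ⟨
    y ∙ y ^ n ∙ x     ≈.∎

  z : Word Generator
  z = c ^ (p ∸ 1)

  za≈az : z ∙ a ≈ a ∙ z
  za≈az = sym (commutes-^ (sym ca≈ac) (p ∸ 1))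

  zb≈bz : z ∙ b ≈ b ∙ z
  zb≈bz = sym (commutes-^ (sym cb≈bc) (p ∸ 1))

  ba≈abz : b ∙ a ≈ a ∙ b ∙ z
  ba≈abz = ≈.begin
    b ∙ a                 ≈.≈⟨ //-rightDividesʳ c (b ∙ a) ⟨
    b ∙ a ∙ c ∙ c ⁻¹      ≈.≈⟨ ∙-cong (sym (trans (commutator-swap a b) (∙-congˡ (relation [a,b]≐c)))) (gen-inverse C) ⟩
    a ∙ b ∙ z             ≈.∎

  baⁱ≈aⁱbzⁱ : ∀ i → b ∙ a ^ i ≈ a ^ i ∙ (b ∙ z ^ i)
  baⁱ≈aⁱbzⁱ zero = trans (identityʳ b) (sym (trans (identityˡ _) (identityʳ b)))
  baⁱ≈aⁱbzⁱ (suc i) = ≈.begin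
    b ∙ (a ∙ a ^ i)               ≈.≈⟨ assoc b a (a ^ i) ⟨
    b ∙ a ∙ a ^ i                 ≈.≈⟨ ∙-congʳ ba≈abz ⟩
    a ∙ b ∙ z ∙ a ^ i             ≈.≈⟨ assoc (a ∙ b) z (a ^ i) ⟩
    a ∙ b ∙ (z ∙ a ^ i)           ≈.≈⟨ ∙-congˡ (commutes-^ za≈az i) ⟩
    a ∙ b ∙ (a ^ i ∙ z)           ≈.≈⟨ assoc a b (a ^ i ∙ z) ⟩
    a ∙ (b ∙ (a ^ i ∙ z))         ≈.≈⟨ ∙-congˡ (assoc b (a ^ i) z) ⟨
    a ∙ (b ∙ a ^ i ∙ z)           ≈.≈⟨ ∙-congˡ (∙-congʳ (baⁱ≈aⁱbzⁱ i)) ⟩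
    a ∙ (a ^ i ∙ (b ∙ z ^ i) ∙ z) ≈.≈⟨ ∙-congˡ (assoc (a ^ i) (b ∙ z ^ i) z) ⟩
    a ∙ (a ^ i ∙ (b ∙ z ^ i ∙ z)) ≈.≈⟨ assoc a (a ^ i) _ ⟨
    a ∙ a ^ i ∙ (b ∙ z ^ i ∙ z)   ≈.≈⟨ ∙-congˡ (assoc b (z ^ i) z) ⟩
    a ∙ a ^ i ∙ (b ∙ (z ^ i ∙ z)) ≈.≈⟨ ∙-congˡ (∙-congˡ (commutes-^ refl i)) ⟨
    a ∙ a ^ i ∙ (b ∙ (z ∙ z ^ i)) ≈.∎

  HasNF : Pred (Word Generator) 0ℓ
  HasNF w = ∃[ i ] ∃[ j ] ∃[ k ] w ≈ nf i j k

  Preserves : Pred (Word Generator) 0ℓ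
  Preserves w = ∀ {n} → HasNF n → HasNF (w ∙ n)

  HasNF-resp : HasNF Respects _≈_
  HasNF-resp u≈v (i , j , k , e) = i , j , k , trans (sym u≈v) e

  Preserves-resp : Preserves Respects _≈_
  Preserves-resp u≈v P h = HasNF-resp (∙-congʳ u≈v) (P h)

  Preserves-ε : Preserves ε
  Preserves-ε h = HasNF-resp (sym (identityˡ _)) h

  Preserves-∙ : ∀ {u v} → Preserves u → Preserves v → Preserves (u ∙ v)
  Preserves-∙ P Q h = HasNF-resp (sym (assoc _ _ _)) (P (Q h))

  Preserves-^ : ∀ {u} → Preserves u → ∀ n → Preserves (u ^ n)
  Preserves-^ P zero    = Preserves-ε
  Preserves-^ P (suc n) = Preserves-∙ P (Preserves-^ P n)

  Preserves-gen : ∀ g → Preserves (gen g)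
  Preserves-gen A (i , j , k , e) = suc i , j , k , (≈.begin
    a ∙ _                         ≈.≈⟨ ∙-congˡ e ⟩
    a ∙ (a ^ i ∙ b ^ j ∙ c ^ k)   ≈.≈⟨ assoc a (a ^ i ∙ b ^ j) (c ^ k) ⟨
    a ∙ (a ^ i ∙ b ^ j) ∙ c ^ k   ≈.≈⟨ ∙-congʳ (assoc a (a ^ i) (b ^ j)) ⟨
    a ∙ a ^ i ∙ b ^ j ∙ c ^ k     ≈.∎)
  Preserves-gen B (i , j , k , e) = i , suc j , i ℕ.* (p ∸ 1) ℕ.+ k , (≈.begin
    b ∙ _                                       ≈.≈⟨ ∙-congˡ e ⟩
    b ∙ (a ^ i ∙ b ^ j ∙ c ^ k)                 ≈.≈⟨ ∙-congˡ (assoc (a ^ i) (b ^ j) (c ^ k)) ⟩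
    b ∙ (a ^ i ∙ (b ^ j ∙ c ^ k))               ≈.≈⟨ assoc b (a ^ i) _ ⟨
    b ∙ a ^ i ∙ (b ^ j ∙ c ^ k)                 ≈.≈⟨ ∙-congʳ (baⁱ≈aⁱbzⁱ i) ⟩
    a ^ i ∙ (b ∙ z ^ i) ∙ (b ^ j ∙ c ^ k)       ≈.≈⟨ assoc (a ^ i) (b ∙ z ^ i) _ ⟩
    a ^ i ∙ (b ∙ z ^ i ∙ (b ^ j ∙ c ^ k))       ≈.≈⟨ ∙-congˡ (assoc b (z ^ i) _) ⟩
    a ^ i ∙ (b ∙ (z ^ i ∙ (b ^ j ∙ c ^ k)))     ≈.≈⟨ ∙-congˡ (∙-congˡ (assoc (z ^ i) (b ^ j) (c ^ k))) ⟨
    a ^ i ∙ (b ∙ (z ^ i ∙ b ^ j ∙ c ^ k))       ≈.≈⟨ ∙-congˡ (∙-congˡ (∙-congʳ zⁱbʲ≈bʲzⁱ)) ⟩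
    a ^ i ∙ (b ∙ (b ^ j ∙ z ^ i ∙ c ^ k))       ≈.≈⟨ ∙-congˡ (∙-congˡ (assoc (b ^ j) (z ^ i) (c ^ k))) ⟩
    a ^ i ∙ (b ∙ (b ^ j ∙ (z ^ i ∙ c ^ k)))     ≈.≈⟨ ∙-congˡ (assoc b (b ^ j) _) ⟨
    a ^ i ∙ (b ∙ b ^ j ∙ (z ^ i ∙ c ^ k))       ≈.≈⟨ assoc (a ^ i) (b ∙ b ^ j) _ ⟨
    a ^ i ∙ (b ∙ b ^ j) ∙ (z ^ i ∙ c ^ k)       ≈.≈⟨ ∙-congˡ (∙-congʳ (^-assoc c i (p ∸ 1))) ⟩
    a ^ i ∙ b ^ suc j ∙ (c ^ (i ℕ.* (p ∸ 1)) ∙ c ^ k)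
                                                ≈.≈⟨ ∙-congˡ (^-homo-+ c (i ℕ.* (p ∸ 1)) k) ⟨
    nf i (suc j) (i ℕ.* (p ∸ 1) ℕ.+ k)          ≈.∎)
    where
    zⁱbʲ≈bʲzⁱ : z ^ i ∙ b ^ j ≈ b ^ j ∙ z ^ i
    zⁱbʲ≈bʲzⁱ = commutes-^ (sym (commutes-^ (sym zb≈bz) i)) j
  Preserves-gen C (i , j , k , e) = i , j , suc k , (≈.begin
    c ∙ _                           ≈.≈⟨ ∙-congˡ e ⟩
    c ∙ (a ^ i ∙ b ^ j ∙ c ^ k)     ≈.≈⟨ assoc c (a ^ i ∙ b ^ j) (c ^ k) ⟨
    c ∙ (a ^ i ∙ b ^ j) ∙ c ^ k     ≈.≈⟨ ∙-congʳ (assoc c (a ^ i) (b ^ j)) ⟨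
    c ∙ a ^ i ∙ b ^ j ∙ c ^ k       ≈.≈⟨ ∙-congʳ (∙-congʳ (commutes-^ ca≈ac i)) ⟩
    a ^ i ∙ c ∙ b ^ j ∙ c ^ k       ≈.≈⟨ ∙-congʳ (assoc (a ^ i) c (b ^ j)) ⟩
    a ^ i ∙ (c ∙ b ^ j) ∙ c ^ k     ≈.≈⟨ ∙-congʳ (∙-congˡ (commutes-^ cb≈bc j)) ⟩
    a ^ i ∙ (b ^ j ∙ c) ∙ c ^ k     ≈.≈⟨ ∙-congʳ (assoc (a ^ i) (b ^ j) c) ⟨
    a ^ i ∙ b ^ j ∙ c ∙ c ^ k       ≈.≈⟨ assoc (a ^ i ∙ b ^ j) c (c ^ k) ⟩
    a ^ i ∙ b ^ j ∙ (c ∙ c ^ k)     ≈.∎)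

  preserves : ∀ w → Preserves w × Preserves (w ⁻¹)
  preserves (gen g) = Preserves-gen g ,
    Preserves-resp (sym (gen-inverse g)) (Preserves-^ (Preserves-gen g) (p ∸ 1))
  preserves ε = Preserves-ε , Preserves-resp (sym ε⁻¹≈ε) Preserves-ε
  preserves (u ∙ v) =
    let P , P⁻ = preserves u ; Q , Q⁻ = preserves v in
    Preserves-∙ P Q , Preserves-resp (sym (⁻¹-anti-homo-∙ u v)) (Preserves-∙ Q⁻ P⁻)
  preserves (u ⁻¹) =
    let P , P⁻ = preserves u in P⁻ , Preserves-resp (sym (⁻¹-involutive u)) P

  hasNF : ∀ w → HasNF w
  hasNF w = HasNF-resp (identityʳ w)
    (proj₁ (preserves w) (0 , 0 , 0 , sym (trans (identityʳ _) (identityʳ _))))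

  Exponents : Set
  Exponents = Fin p × Fin p × Fin p

  word : Exponents → Word Generator
  word (i , j , k) = nf (toℕ i) (toℕ j) (toℕ k)

  reduce : ℕ → Fin p
  reduce n = fromℕ< (m%n<n n p)

  exponents : Word Generator → Exponents
  exponents w = let i , j , k , _ = hasNF w in reduce i , reduce j , reduce k

  word-exponents : ∀ w → word (exponents w) ≈ w
  word-exponents w =
    let i , j , k , e = hasNF w in
    sym (trans e (∙-cong (∙-cong (^-toℕ A i) (^-toℕ B j)) (^-toℕ C k)))
    where
    ^-toℕ : ∀ g n → gen g ^ n ≈ gen g ^ toℕ (reduce n)
    ^-toℕ g n = ≡.subst (λ m → gen g ^ n ≈ gen g ^ m) (≡.sym (toℕ-fromℕ< (m%n<n n p))) (^-reduce g n)

  word-injective : ∀ {s t} → word s ≈ word t → s ≡ t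
  word-injective {i , j , k} {i′ , j′ , k′} e
    with x , y , w ← ≡.subst₂ _≋_ (eval-nf _ _ _) (eval-nf _ _ _) (eval-cong e) =
      ≡.cong₂ _,_ (same x) (≡.cong₂ _,_ (same y) (same w))
    where
    same : ∀ {i j : Fin p} → + toℕ i ≡ₚ + toℕ j → i ≡ j
    same {i} {j} e = toℕ-injective (≡ₚ⇒≡ (toℕ<n i) (toℕ<n j) e)

  finite : IsFinite setoid
  finite = p ℕ.* (p ℕ.* p) , record
    { to        = word ∘ split
    ; from      = unsplit ∘ exponents
    ; to-cong   = λ { ≡.refl → refl }
    ; from-cong = λ {u} {v} u≈v → ≡.cong unsplit (word-injective
        (trans (word-exponents u) (trans u≈v (sym (word-exponents v)))))
    ; inverse   = (λ {w} e → trans (word-to e) (word-exponents w))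
                , (λ {i} {w} e → ≡.trans
                    (≡.cong unsplit (word-injective (trans (word-exponents w) e)))
                    (unsplit-split i))
    }
    where
    split : Fin (p ℕ.* (p ℕ.* p)) → Exponents
    split n = map₂ (remQuot {p} p) (remQuot {p} (p ℕ.* p) n)
    unsplit : Exponents → Fin (p ℕ.* (p ℕ.* p))
    unsplit (i , j , k) = combine i (combine j k)
    split-unsplit : ∀ t → split (unsplit t) ≡ t
    split-unsplit (i , j , k) = ≡.trans
      (≡.cong (map₂ (remQuot {p} p)) (remQuot-combine i (combine j k)))
      (≡.cong (i ,_) (remQuot-combine j k))
    unsplit-split : ∀ n → unsplit (split n) ≡ n
    unsplit-split n = ≡.trans
      (≡.cong (combine (proj₁ (remQuot {p} (p ℕ.* p) n)))
        (combine-remQuot {p} p (proj₂ (remQuot {p} (p ℕ.* p) n))))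
      (combine-remQuot {p} (p ℕ.* p) n)
    word-to : ∀ {n t} → n ≡ unsplit t → word (split n) ≈ word t
    word-to {t = t} ≡.refl = ≡.subst (λ s → word s ≈ word t) (≡.sym (split-unsplit t)) refl

  G : FiniteGroup
  G = record { group = presentedGroup ; finite = finite }

  S : Pred (Word Generator) 0ℓ
  S x = ∃[ i ] (1 ≤ i × i ≤ p ∸ 1 × (x ≈ a ^ i ⊎ x ≈ b ^ i))

  private
    i<p : ∀ {i} → i ≤ p ∸ 1 → i < p
    i<p i≤p-1 = ℕₚ.≤-<-trans i≤p-1 (ℕₚ.∸-monoʳ-< {p} (s≤s z≤n) (ℕₚ.n≢0⇒n>0 (ℕ.≢-nonZero⁻¹ p)))

    ε∉S : ε ∉ S
    ε∉S (suc i , _ , i≤ , inj₁ e)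
      with x , _ ← ≡.subst (_ ≋_) (eval-aⁿ (suc i)) (eval-cong e)
      with () ← ≡ₚ⇒≡ (i<p z≤n) (i<p i≤) x
    ε∉S (suc i , _ , i≤ , inj₂ e)
      with _ , y , _ ← ≡.subst (_ ≋_) (eval-bⁿ (suc i)) (eval-cong e)
      with () ← ≡ₚ⇒≡ (i<p z≤n) (i<p i≤) y

    S-⁻¹-closed : ∀ {x} → x ∈ S → x ⁻¹ ∈ S
    S-⁻¹-closed (i , 1≤i , i≤ , e) =
      p ∸ i , ℕₚ.m<n⇒0<n∸m (i<p i≤) , ℕₚ.∸-monoʳ-≤ p 1≤i , Sum.map (inv A) (inv B) e
      where
      inv : ∀ g {x} → x ≈ gen g ^ i → x ⁻¹ ≈ gen g ^ (p ∸ i)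
      inv g x≈ = trans (⁻¹-cong x≈) (^-inverse g i (ℕₚ.<⇒≤ (i<p i≤)))

  connectionSet : ConnectionSet G
  connectionSet = record
    { S         = S
    ; resp      = λ { x≈y (i , 1≤i , i≤ , e) →
        i , 1≤i , i≤ , Sum.map (trans (sym x≈y)) (trans (sym x≈y)) e }
    ; ε∉        = ε∉S
    ; ⁻¹-closed = S-⁻¹-closed
    }

{-# OPTIONS --safe #-}
module Submission where

open import Defs
open import Algebra.Bundles using (Group)
open import Data.Fin.Base using (Fin; toℕ)
open import Data.Fin.Patterns using (0F; 1F; 2F)
open import Data.Fin.Properties using (toℕ-injective; toℕ<n)
open import Data.Integer.Base as ℤ using (ℤ; +_; 0ℤ; 1ℤ)
open import Data.Integer.DivMod using (_%ℕ_; _/ℕ_; n%ℕd<d; a≡a%ℕn+[a/ℕn]*n)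
import Data.Integer.Properties as ℤₚ
open import Data.Integer.Tactic.RingSolver using (solve)
open import Data.List.Base using (_∷_; [])
open import Data.Nat.Base as ℕ using (ℕ; zero; suc)
open import Data.Nat.Coprimality using (prime⇒coprime; coprime-Bézout)
open import Data.Nat.Divisibility using (_∣_; ∣-refl)
open import Data.Nat.GCD using (module Bézout)
open import Data.Nat.Primality using (Prime; prime⇒nonZero; prime⇒nonTrivial)
import Data.Nat.Properties as ℕₚ
open import Data.Product.Base using (∃-syntax; _×_; _,_; proj₁; proj₂)
open import Data.Sum.Base as Sum using (_⊎_; inj₁; inj₂; [_,_]′)
open import Data.Vec.Functional as Vector using (Vector)
open import Function.Bundles using (Equivalence; mk⇔)
open import Level using (0ℓ)
open import Relation.Binary.Bundles using (Setoid)
open import Relation.Binary.Core using (Rel)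
open import Relation.Binary.Definitions using (Decidable)
open import Relation.Binary.PropositionalEquality as ≡ using (_≡_)
import Relation.Binary.Reasoning.Setoid as SetoidReasoning
open import Relation.Nullary.Decidable.Core as Dec using (yes; no; decidable-stable)
open import Relation.Nullary.Negation using (¬_; contradiction)

-- In the coordinates (x , y , z) of aˣ bʸ cᶻ an edge changes either x alone or y alone, in
-- the latter case keeping w = z + x y.  So vertices are the flags of an incidence structure
-- of points (y , z) and lines (x , w), an affine plane with one parallel class removed, and
-- Γ is its flag graph.  The stabiliser of ε contains (x , y , z) ↦ (α x , β y , α β z) and
-- (x , y , z) ↦ (y , x , − w); with R(G) these act transitively on the pairs at distance 1
-- and on those at distance 2.
--
-- For normality: an edge lies in triangles only with edges of its own kind, so by
-- connectedness an automorphism preserves or swaps the two kinds, and the swap lets us assume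
-- the former.  Then it permutes the lines of each kind, and also their parallel classes, so
-- that x, y, (y , z) and (x , w) are transformed separately, by f, g, h and k with
-- h(y , z) + f(x) g(y) = k(x , z + x y).  This equation makes f − f(0) and g − g(0)
-- additive, whence the automorphism normalises the right translations.

module _ (p : ℕ) (p-prime : Prime p) where
  private
    instance
      p-nonZero : ℕ.NonZero p
      p-nonZero = prime⇒nonZero p-prime

  open Heisenberg p {{prime⇒nonZero p-prime}}

  -- Arithmetic modulo p

  infixl 6 _⊕_
  infixl 7 _⊛_

  -- A congruence follows from others once the difference of its sides is a
  -- linear combination of theirs.
  _⊛_ : ∀ m {x y} → x ≡ₚ y → m ℤ.* (x ℤ.- y) ≡ₚ 0ℤ
  _⊛_ m {y = y} (congruent q ≡.refl) = congruent (m ℤ.* q) (lemma m y q (+ p))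
    where
    lemma : ∀ m y q n → m ℤ.* (y ℤ.+ q ℤ.* n ℤ.- y) ≡ 0ℤ ℤ.+ m ℤ.* q ℤ.* n
    lemma m y q n = solve (m ∷ y ∷ q ∷ n ∷ [])

  _⊕_ : ∀ {x y} → x ≡ₚ 0ℤ → y ≡ₚ 0ℤ → x ℤ.+ y ≡ₚ 0ℤ
  _⊕_ = +-congₚ

  combine : ∀ {x y e} → e ≡ₚ 0ℤ → x ℤ.- y ≡ e → x ≡ₚ y
  combine {x} {y} (congruent q ≡.refl) x-y≡e = congruent q
    (≡.trans (lemma x y) (≡.trans (≡.cong (λ d → y ℤ.+ d) x-y≡e) (≡.cong (λ d → y ℤ.+ d) (ℤₚ.+-identityˡ _))))
    where
    lemma : ∀ x y → x ≡ y ℤ.+ (x ℤ.- y)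
    lemma x y = solve (x ∷ y ∷ [])

  residue : ∀ x → x ≡ₚ + (x %ℕ p)
  residue x = congruent (x /ℕ p) (a≡a%ℕn+[a/ℕn]*n x p)

  residue-injective : ∀ {x y} → x %ℕ p ≡ y %ℕ p → x ≡ₚ y
  residue-injective {x} {y} e = ≡ₚ-trans (residue x) (≡ₚ-trans (≡⇒≡ₚ (≡.cong +_ e)) (≡ₚ-sym (residue y)))

  residue-cong : ∀ {x y} → x ≡ₚ y → x %ℕ p ≡ y %ℕ p
  residue-cong {x} {y} x≡y = ≡ₚ⇒≡ (n%ℕd<d x p) (n%ℕd<d y p)
    (≡ₚ-trans (≡ₚ-sym (residue x)) (≡ₚ-trans x≡y (residue y)))

  infix 4 _≟ₚ_
  _≟ₚ_ : Decidable _≡ₚ_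
  x ≟ₚ y with x %ℕ p ℕₚ.≟ y %ℕ p
  ... | yes e = yes (residue-injective e)
  ... | no ≢  = no λ x≡y → ≢ (residue-cong x≡y)

  -- A residue strictly between 0 and the prime p is coprime to p, so its coefficient in a Bézout
  -- identity is an inverse. Over ℕ the identity comes in two forms, hence the two signs below.
  inverseₚ : ∀ {x} → ¬ x ≡ₚ 0ℤ → ∃[ y ] y ℤ.* x ≡ₚ 1ℤ
  inverseₚ {x} x≢0 = inverse-of-residue (x %ℕ p) (n%ℕd<d x p) (residue x)
    where
    inverse-of-residue : ∀ r → r ℕ.< p → x ≡ₚ + r → ∃[ y ] y ℤ.* x ≡ₚ 1ℤ
    inverse-of-residue zero        _   x≡r = contradiction x≡r x≢0
    inverse-of-residue r@(suc _) r<p x≡r with coprime-Bézout (prime⇒coprime p-prime r<p)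
    ... | Bézout.+- u v e = ℤ.- + v , lemma (+ u) (+ v) (≡⇒≡ₚ bézout) x≡r p≡ₚ0
      where
      bézout : 1ℤ ℤ.+ + v ℤ.* + r ≡ + u ℤ.* + p
      bézout = ≡.trans (≡.cong (λ n → 1ℤ ℤ.+ n) (≡.sym (ℤₚ.pos-* v r)))
        (≡.trans (≡.cong +_ e) (ℤₚ.pos-* u p))
      lemma : ∀ u v {r n x} → 1ℤ ℤ.+ v ℤ.* r ≡ₚ u ℤ.* n → x ≡ₚ r → n ≡ₚ 0ℤ → ℤ.- v ℤ.* x ≡ₚ 1ℤ
      lemma u v {r} {n} {x} e x≡r n≡0 =
        combine (ℤ.- 1ℤ ⊛ e ⊕ ℤ.- v ⊛ x≡r ⊕ ℤ.- u ⊛ n≡0) (solve (u ∷ v ∷ r ∷ n ∷ x ∷ []))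
    ... | Bézout.-+ u v e = + v , lemma (+ u) (+ v) (≡⇒≡ₚ bézout) x≡r p≡ₚ0
      where
      bézout : 1ℤ ℤ.+ + u ℤ.* + p ≡ + v ℤ.* + r
      bézout = ≡.trans (≡.cong (λ n → 1ℤ ℤ.+ n) (≡.sym (ℤₚ.pos-* u p)))
        (≡.trans (≡.cong +_ e) (ℤₚ.pos-* v r))
      lemma : ∀ u v {r n x} → 1ℤ ℤ.+ u ℤ.* n ≡ₚ v ℤ.* r → x ≡ₚ r → n ≡ₚ 0ℤ → v ℤ.* x ≡ₚ 1ℤ
      lemma u v {r} {n} {x} e x≡r n≡0 =
        combine (ℤ.- 1ℤ ⊛ e ⊕ v ⊛ x≡r ⊕ u ⊛ n≡0) (solve (u ∷ v ∷ r ∷ n ∷ x ∷ []))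

  *-cancelˡₚ : ∀ {m} → ¬ m ≡ₚ 0ℤ → ∀ {x y} → m ℤ.* x ≡ₚ m ℤ.* y → x ≡ₚ y
  *-cancelˡₚ {m} m≢0 mx≡my = let m⁻¹ , m⁻¹m≡1 = inverseₚ m≢0 in lemma m⁻¹ mx≡my m⁻¹m≡1
    where
    lemma : ∀ m⁻¹ {x y} → m ℤ.* x ≡ₚ m ℤ.* y → m⁻¹ ℤ.* m ≡ₚ 1ℤ → x ≡ₚ y
    lemma m⁻¹ {x} {y} mx≡my m⁻¹m≡1 =
      combine (m⁻¹ ⊛ mx≡my ⊕ (y ℤ.- x) ⊛ m⁻¹m≡1) (solve (m ∷ m⁻¹ ∷ x ∷ y ∷ []))

  1≢0 : ¬ 1ℤ ≡ₚ 0ℤ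
  1≢0 e with () ← ≡ₚ⇒≡ (ℕ.nonTrivial⇒n>1 p {{prime⇒nonTrivial p-prime}}) (ℕ.>-nonZero⁻¹ p) e

  divideₚ : ∀ {d} → ¬ d ≡ₚ 0ℤ → ∀ e → ∃[ u ] u ℤ.* d ≡ₚ e
  divideₚ {d} d≢0 e = let d⁻¹ , d⁻¹d≡1 = inverseₚ d≢0 in e ℤ.* d⁻¹ , lemma d⁻¹ d⁻¹d≡1
    where
    lemma : ∀ d⁻¹ → d⁻¹ ℤ.* d ≡ₚ 1ℤ → e ℤ.* d⁻¹ ℤ.* d ≡ₚ e
    lemma d⁻¹ d⁻¹d≡1 = combine (e ⊛ d⁻¹d≡1) (solve (d ∷ d⁻¹ ∷ e ∷ []))

  -- Coordinates and adjacency

  word-of : Triple → Word Generator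
  word-of (x , y , z) = nf (x %ℕ p) (y %ℕ p) (z %ℕ p)

  eval-word-of : ∀ t → eval (word-of t) ≋ t
  eval-word-of t@(x , y , z) = ≡.subst (_≋ t) (≡.sym (eval-nf (x %ℕ p) (y %ℕ p) (z %ℕ p)))
    (≡ₚ-sym (residue x) , ≡ₚ-sym (residue y) , ≡ₚ-sym (residue z))

  ≋-setoid : Setoid 0ℓ 0ℓ
  ≋-setoid = record
    { Carrier = Triple
    ; _≈_ = _≋_
    ; isEquivalence = record
      { refl  = ≡⇒≋ ≡.refl
      ; sym   = λ (x , y , z) → ≡ₚ-sym x , ≡ₚ-sym y , ≡ₚ-sym z
      ; trans = λ (x , y , z) (x′ , y′ , z′) → ≡ₚ-trans x x′ , ≡ₚ-trans y y′ , ≡ₚ-trans z z′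
      }
    }

  module ≋ = SetoidReasoning ≋-setoid

  -- Both words equal normal forms with exponents below p, where congruent exponents are equal. With
  -- `eval-cong`, equality in G becomes congruence of coordinates.
  eval-injective : ∀ {u v} → eval u ≋ eval v → u ≈ v
  eval-injective {u} {v} e = ≈.begin
    u                      ≈.≈⟨ word-exponents u ⟨
    word (exponents u)     ≈.≡⟨ ≡.cong word exponents≡ ⟩
    word (exponents v)     ≈.≈⟨ word-exponents v ⟩
    v                      ≈.∎
    where
    eval-word : ∀ s → eval (word s) ≡ (+ toℕ (proj₁ s) , + toℕ (proj₁ (proj₂ s)) , + toℕ (proj₂ (proj₂ s)))
    eval-word (i , j , k) = eval-nf (toℕ i) (toℕ j) (toℕ k)
    same : ∀ {i j : Fin p} → + toℕ i ≡ₚ + toℕ j → i ≡ j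
    same {i} {j} e = toℕ-injective (≡ₚ⇒≡ (toℕ<n i) (toℕ<n j) e)
    coordinates : eval (word (exponents u)) ≋ eval (word (exponents v))
    coordinates = ≋.begin
      eval (word (exponents u))  ≋.≈⟨ eval-cong (word-exponents u) ⟩
      eval u                     ≋.≈⟨ e ⟩
      eval v                     ≋.≈⟨ eval-cong (word-exponents v) ⟨
      eval (word (exponents v))  ≋.∎
    exponents≡ : exponents u ≡ exponents v
    exponents≡ with x , y , z ← ≡.subst₂ _≋_ (eval-word (exponents u)) (eval-word (exponents v)) coordinates =
      ≡.cong₂ _,_ (same x) (≡.cong₂ _,_ (same y) (same z))

  data Kind : Set where
    𝐚 𝐛 : Kind

  -- Edges g — aⁱ g fix the coordinates y and z; edges g — bʲ g fix x and z + x y.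
  Joined : Kind → Rel Triple 0ℓ
  Joined 𝐚 (x , y , z) (x′ , y′ , z′) = ¬ x ≡ₚ x′ × y ≡ₚ y′ × z ≡ₚ z′
  Joined 𝐛 (x , y , z) (x′ , y′ , z′) = ¬ y ≡ₚ y′ × x ≡ₚ x′ × z ℤ.+ x ℤ.* y ≡ₚ z′ ℤ.+ x′ ℤ.* y′

  Γ : Graph
  Γ = Cay G connectionSet

  open Graph Γ using (Adj)

  positive⇒≢0 : ∀ {n} → 1 ℕ.≤ n → n ℕ.≤ p ℕ.∸ 1 → ¬ + n ≡ₚ 0ℤ
  positive⇒≢0 {suc n} _ n≤p-1 n≡0
    with () ← ≡ₚ⇒≡ (ℕₚ.≤-<-trans n≤p-1 (ℕₚ.≤-reflexive (ℕₚ.suc-pred p))) (ℕ.>-nonZero⁻¹ p) n≡0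

  X Y Z : Word Generator → ℤ
  X g = proj₁ (eval g)
  Y g = proj₁ (proj₂ (eval g))
  Z g = proj₂ (proj₂ (eval g))

  adjacent⇒joined : ∀ {g h} → Adj g h → ∃[ k ] Joined k (eval g) (eval h)
  adjacent⇒joined {g} {h} (i , 1≤i , i≤p-1 , inj₁ e) = 𝐚 ,
    lemma (X g) (Y g) (Z g) (X h) (Y h) (Z h) (positive⇒≢0 1≤i i≤p-1)
      (≡.subst (eval (h ∙ g ⁻¹) ≋_) (eval-aⁿ i) (eval-cong e))
    where
    -- The triple on the left of `_≋_` is `eval (h ∙ g ⁻¹)` multiplied out, with plain variables so
    -- that `solve` applies.
    lemma : ∀ x y z x′ y′ z′ {i} → ¬ i ≡ₚ 0ℤ →
      (x′ ℤ.+ ℤ.- x , y′ ℤ.+ ℤ.- y , z′ ℤ.+ (ℤ.- z ℤ.+ ℤ.- (y ℤ.* x)) ℤ.+ ℤ.- (y′ ℤ.* ℤ.- x)) ≋ (i , 0ℤ , 0ℤ) →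
      Joined 𝐚 (x , y , z) (x′ , y′ , z′)
    lemma x y z x′ y′ z′ {i} i≢0 (x≡ , y≡ , z≡) =
      (λ x≡x′ → i≢0 (combine (ℤ.- 1ℤ ⊛ x≡ ⊕ ℤ.- 1ℤ ⊛ x≡x′) (solve (i ∷ x ∷ x′ ∷ [])))) ,
      combine (ℤ.- 1ℤ ⊛ y≡) (solve (y ∷ y′ ∷ [])) ,
      combine (ℤ.- 1ℤ ⊛ z≡ ⊕ x ⊛ y≡) (solve (x ∷ y ∷ z ∷ y′ ∷ z′ ∷ []))
  adjacent⇒joined {g} {h} (j , 1≤j , j≤p-1 , inj₂ e) = 𝐛 ,
    lemma (X g) (Y g) (Z g) (X h) (Y h) (Z h) (positive⇒≢0 1≤j j≤p-1)
      (≡.subst (eval (h ∙ g ⁻¹) ≋_) (eval-bⁿ j) (eval-cong e))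
    where
    lemma : ∀ x y z x′ y′ z′ {j} → ¬ j ≡ₚ 0ℤ →
      (x′ ℤ.+ ℤ.- x , y′ ℤ.+ ℤ.- y , z′ ℤ.+ (ℤ.- z ℤ.+ ℤ.- (y ℤ.* x)) ℤ.+ ℤ.- (y′ ℤ.* ℤ.- x)) ≋ (0ℤ , j , 0ℤ) →
      Joined 𝐛 (x , y , z) (x′ , y′ , z′)
    lemma x y z x′ y′ z′ {j} j≢0 (x≡ , y≡ , z≡) =
      (λ y≡y′ → j≢0 (combine (ℤ.- 1ℤ ⊛ y≡ ⊕ ℤ.- 1ℤ ⊛ y≡y′) (solve (j ∷ y ∷ y′ ∷ [])))) ,
      combine (ℤ.- 1ℤ ⊛ x≡) (solve (x ∷ x′ ∷ [])) ,
      combine (ℤ.- 1ℤ ⊛ z≡ ⊕ ℤ.- y′ ⊛ x≡) (solve (x ∷ y ∷ z ∷ x′ ∷ y′ ∷ z′ ∷ []))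

  residue-positive : ∀ {d} → ¬ d ≡ₚ 0ℤ → 1 ℕ.≤ d %ℕ p × d %ℕ p ℕ.≤ p ℕ.∸ 1
  residue-positive {d} d≢0 =
    ℕₚ.n≢0⇒n>0 (λ r≡0 → d≢0 (≡ₚ-trans (residue d) (≡⇒≡ₚ (≡.cong +_ r≡0)))) ,
    ℕₚ.<⇒≤pred (n%ℕd<d d p)

  joined⇒adjacent : ∀ k {g h} → Joined k (eval g) (eval h) → Adj g h
  joined⇒adjacent 𝐚 {g} {h} joined =
    let d , d≢0 , e = lemma (X g) (Y g) (Z g) (X h) (Y h) (Z h) joined
        1≤i , i≤p-1 = residue-positive d≢0
    in d %ℕ p , 1≤i , i≤p-1 , inj₁ (eval-injective
      (≡.subst (eval (h ∙ g ⁻¹) ≋_) (≡.sym (eval-aⁿ (d %ℕ p))) e))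
    where
    lemma : ∀ x y z x′ y′ z′ → Joined 𝐚 (x , y , z) (x′ , y′ , z′) → ∃[ d ] (¬ d ≡ₚ 0ℤ ×
      (x′ ℤ.+ ℤ.- x , y′ ℤ.+ ℤ.- y , z′ ℤ.+ (ℤ.- z ℤ.+ ℤ.- (y ℤ.* x)) ℤ.+ ℤ.- (y′ ℤ.* ℤ.- x)) ≋ (+ (d %ℕ p) , 0ℤ , 0ℤ))
    lemma x y z x′ y′ z′ (x≢ , y≡ , z≡) =
      x′ ℤ.+ ℤ.- x ,
      (λ d≡0 → x≢ (combine (ℤ.- 1ℤ ⊛ d≡0) (solve (x ∷ x′ ∷ [])))) ,
      residue _ ,
      combine (ℤ.- 1ℤ ⊛ y≡) (solve (y ∷ y′ ∷ [])) ,
      combine (ℤ.- 1ℤ ⊛ z≡ ⊕ ℤ.- x ⊛ y≡) (solve (x ∷ y ∷ z ∷ y′ ∷ z′ ∷ []))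
  joined⇒adjacent 𝐛 {g} {h} joined =
    let d , d≢0 , e = lemma (X g) (Y g) (Z g) (X h) (Y h) (Z h) joined
        1≤j , j≤p-1 = residue-positive d≢0
    in d %ℕ p , 1≤j , j≤p-1 , inj₂ (eval-injective
      (≡.subst (eval (h ∙ g ⁻¹) ≋_) (≡.sym (eval-bⁿ (d %ℕ p))) e))
    where
    lemma : ∀ x y z x′ y′ z′ → Joined 𝐛 (x , y , z) (x′ , y′ , z′) → ∃[ d ] (¬ d ≡ₚ 0ℤ ×
      (x′ ℤ.+ ℤ.- x , y′ ℤ.+ ℤ.- y , z′ ℤ.+ (ℤ.- z ℤ.+ ℤ.- (y ℤ.* x)) ℤ.+ ℤ.- (y′ ℤ.* ℤ.- x)) ≋ (0ℤ , + (d %ℕ p) , 0ℤ))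
    lemma x y z x′ y′ z′ (y≢ , x≡ , w≡) =
      y′ ℤ.+ ℤ.- y ,
      (λ d≡0 → y≢ (combine (ℤ.- 1ℤ ⊛ d≡0) (solve (y ∷ y′ ∷ [])))) ,
      combine (ℤ.- 1ℤ ⊛ x≡) (solve (x ∷ x′ ∷ [])) ,
      residue _ ,
      combine (ℤ.- 1ℤ ⊛ w≡ ⊕ y′ ⊛ x≡) (solve (x ∷ y ∷ z ∷ x′ ∷ y′ ∷ z′ ∷ []))

  Joined-resp : ∀ k s s′ t t′ → s ≋ s′ → t ≋ t′ → Joined k s t → Joined k s′ t′
  Joined-resp 𝐚 s s′ t t′ (sx , sy , sz) (tx , ty , tz) (x≢ , y≡ , z≡) =
    (λ x≡ → x≢ (≡ₚ-trans sx (≡ₚ-trans x≡ (≡ₚ-sym tx)))) ,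
    ≡ₚ-trans (≡ₚ-sym sy) (≡ₚ-trans y≡ ty) ,
    ≡ₚ-trans (≡ₚ-sym sz) (≡ₚ-trans z≡ tz)
  Joined-resp 𝐛 s s′ t t′ (sx , sy , sz) (tx , ty , tz) (y≢ , x≡ , w≡) =
    (λ y≡ → y≢ (≡ₚ-trans sy (≡ₚ-trans y≡ (≡ₚ-sym ty)))) ,
    ≡ₚ-trans (≡ₚ-sym sx) (≡ₚ-trans x≡ tx) ,
    ≡ₚ-trans (≡ₚ-sym (+-congₚ sz (*-congₚ sx sy))) (≡ₚ-trans w≡ (+-congₚ tz (*-congₚ tx ty)))

  Joined-sym : ∀ k s t → Joined k s t → Joined k t s
  Joined-sym 𝐚 _ _ (≢ , ≡₁ , ≡₂) = (λ e → ≢ (≡ₚ-sym e)) , ≡ₚ-sym ≡₁ , ≡ₚ-sym ≡₂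
  Joined-sym 𝐛 _ _ (≢ , ≡₁ , ≡₂) = (λ e → ≢ (≡ₚ-sym e)) , ≡ₚ-sym ≡₁ , ≡ₚ-sym ≡₂

  -- Automorphisms and orbits on pairs at distance at most 2

  -- The kind of an edge may change, as it does under the swap. Edges need only be preserved: that
  -- they are also reflected comes from applying the same property to the inverse map.
  record JoinedMap : Set where
    field
      map        : Triple → Triple
      map-cong   : ∀ s t → s ≋ t → map s ≋ map t
      map-joined : ∀ k s t → Joined k s t → ∃[ l ] Joined l (map s) (map t)

  module _ (f f⁻¹ : JoinedMap) where
    private
      module f = JoinedMap f
      module f⁻¹ = JoinedMap f⁻¹

    automorphism : (∀ t → f.map (f⁻¹.map t) ≋ t) → (∀ t → f⁻¹.map (f.map t) ≋ t) → Automorphism Γ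
    automorphism inverseˡ′ inverseʳ′ = record
      { perm = record
        { to        = to
        ; from      = from
        ; to-cong   = λ {u} {v} u≈v → eval-injective (≋.begin
            eval (to u)     ≋.≈⟨ eval-word-of _ ⟩
            f.map (eval u)  ≋.≈⟨ f.map-cong _ _ (eval-cong u≈v) ⟩
            f.map (eval v)  ≋.≈⟨ eval-word-of _ ⟨
            eval (to v)     ≋.∎)
        ; from-cong = from-cong
        ; inverse   = (λ {u} {v} v≈ → eval-injective (≋.begin
            eval (to v)               ≋.≈⟨ eval-word-of _ ⟩
            f.map (eval v)            ≋.≈⟨ f.map-cong _ _ (eval-cong v≈) ⟩
            f.map (eval (from u))     ≋.≈⟨ f.map-cong _ _ (eval-word-of _) ⟩
            f.map (f⁻¹.map (eval u))  ≋.≈⟨ inverseˡ′ _ ⟩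
            eval u                    ≋.∎))
          , (λ {u} {v} v≈ → trans (from-cong v≈) (from-to u))
        }
      ; Adj-⇔ = λ {u} {v} → mk⇔
          (λ uv →
            let k , j = adjacent⇒joined uv
                l , j′ = f.map-joined k _ _ j
            in joined⇒adjacent l (Joined-resp l _ _ _ _
              (Setoid.sym ≋-setoid {eval (to u)} {f.map (eval u)} (eval-word-of _))
              (Setoid.sym ≋-setoid {eval (to v)} {f.map (eval v)} (eval-word-of _)) j′))
          (λ uv →
            let k , j = adjacent⇒joined uv
                l , j′ = f⁻¹.map-joined k _ _ (Joined-resp k _ _ _ _
                  (eval-word-of (f.map (eval u))) (eval-word-of (f.map (eval v))) j)
            in joined⇒adjacent l (Joined-resp l _ _ _ _ (inverseʳ′ (eval u)) (inverseʳ′ (eval v)) j′))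
      }
      where
      to from : Word Generator → Word Generator
      to g = word-of (f.map (eval g))
      from g = word-of (f⁻¹.map (eval g))
      from-cong : ∀ {u v} → u ≈ v → from u ≈ from v
      from-cong {u} {v} u≈v = eval-injective (≋.begin
        eval (from u)     ≋.≈⟨ eval-word-of _ ⟩
        f⁻¹.map (eval u)  ≋.≈⟨ f⁻¹.map-cong _ _ (eval-cong u≈v) ⟩
        f⁻¹.map (eval v)  ≋.≈⟨ eval-word-of _ ⟨
        eval (from v)     ≋.∎)
      from-to : ∀ u → from (to u) ≈ u
      from-to u = eval-injective (≋.begin
        eval (from (to u))        ≋.≈⟨ eval-word-of _ ⟩
        f⁻¹.map (eval (to u))     ≋.≈⟨ f⁻¹.map-cong _ _ (eval-word-of _) ⟩
        f⁻¹.map (f.map (eval u))  ≋.≈⟨ inverseʳ′ _ ⟩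
        eval u                    ≋.∎)

  opposite : Kind → Kind
  opposite 𝐚 = 𝐛
  opposite 𝐛 = 𝐚

  -- In the group this is a ↦ b, b ↦ a, c ↦ c⁻¹: moving bˣ past aʸ contributes c to the power - x y.
  swapᵗ : JoinedMap
  swapᵗ = record
    { map        = λ (x , y , z) → y , x , ℤ.- (z ℤ.+ x ℤ.* y)
    ; map-cong   = λ _ _ (x , y , z) → y , x , neg-congₚ (+-congₚ z (*-congₚ x y))
    ; map-joined = λ k s t j → opposite k , joined k s t j
    }
    where
    swap-w : ∀ x y z x′ y′ z′ → x ≡ₚ x′ → z ≡ₚ z′ →
      ℤ.- (z ℤ.+ y ℤ.* x) ℤ.+ x ℤ.* y ≡ₚ ℤ.- (z′ ℤ.+ y′ ℤ.* x′) ℤ.+ x′ ℤ.* y′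
    swap-w x y z x′ y′ z′ x≡ z≡ = combine (ℤ.- 1ℤ ⊛ z≡) (solve (x ∷ y ∷ z ∷ x′ ∷ y′ ∷ z′ ∷ []))
    joined : ∀ k s t → Joined k s t →
      Joined (opposite k) (let (x , y , z) = s in y , x , ℤ.- (z ℤ.+ x ℤ.* y))
        (let (x , y , z) = t in y , x , ℤ.- (z ℤ.+ x ℤ.* y))
    joined 𝐚 (x , y , z) (x′ , y′ , z′) (x≢ , y≡ , z≡) = x≢ , y≡ , swap-w y x z y′ x′ z′ y≡ z≡
    joined 𝐛 _ _ (y≢ , x≡ , w≡) = y≢ , x≡ , neg-congₚ w≡

  swap : Automorphism Γ
  swap = automorphism swapᵗ swapᵗ involutive involutive
    where
    involutive : ∀ t → JoinedMap.map swapᵗ (JoinedMap.map swapᵗ t) ≋ t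
    involutive (x , y , z) = r≡r , r≡r , ≡⇒≡ₚ (lemma x y z)
      where
      r≡r : ∀ {x} → x ≡ₚ x
      r≡r = ≡⇒≡ₚ ≡.refl
      lemma : ∀ x y z → ℤ.- (ℤ.- (z ℤ.+ x ℤ.* y) ℤ.+ y ℤ.* x) ≡ z
      lemma x y z = solve (x ∷ y ∷ z ∷ [])

  -- In the group this raises a to the power α and b to the power β, hence c = [a , b] to the power
  -- α β.
  scaleᵗ : ∀ α β → ¬ α ≡ₚ 0ℤ → ¬ β ≡ₚ 0ℤ → JoinedMap
  scaleᵗ α β α≢0 β≢0 = record
    { map        = λ (x , y , z) → α ℤ.* x , β ℤ.* y , α ℤ.* β ℤ.* z
    ; map-cong   = λ _ _ (x , y , z) → α *-cong x , β *-cong y , α ℤ.* β *-cong z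
    ; map-joined = λ k s t j → k , joined k s t j
    }
    where
    infix 5 _*-cong_
    _*-cong_ : ∀ m {x y} → x ≡ₚ y → m ℤ.* x ≡ₚ m ℤ.* y
    m *-cong e = *-congₚ (≡⇒≡ₚ {m} ≡.refl) e
    joined : ∀ k s t → Joined k s t →
      Joined k (let (x , y , z) = s in α ℤ.* x , β ℤ.* y , α ℤ.* β ℤ.* z)
        (let (x , y , z) = t in α ℤ.* x , β ℤ.* y , α ℤ.* β ℤ.* z)
    joined 𝐚 _ _ (x≢ , y≡ , z≡) = (λ e → x≢ (*-cancelˡₚ α≢0 e)) , β *-cong y≡ , α ℤ.* β *-cong z≡
    joined 𝐛 (x , y , z) (x′ , y′ , z′) (y≢ , x≡ , w≡) =
      (λ e → y≢ (*-cancelˡₚ β≢0 e)) , α *-cong x≡ ,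
      combine (α ℤ.* β ⊛ w≡) (solve (α ∷ β ∷ x ∷ y ∷ z ∷ x′ ∷ y′ ∷ z′ ∷ []))

  scale : ∀ α β → ¬ α ≡ₚ 0ℤ → ¬ β ≡ₚ 0ℤ → Automorphism Γ
  scale α β α≢0 β≢0 =
    let α⁻¹ , α⁻¹α≡1 = inverseₚ α≢0
        β⁻¹ , β⁻¹β≡1 = inverseₚ β≢0
        αα⁻¹≡1 = ≡ₚ-trans (≡⇒≡ₚ (ℤₚ.*-comm α α⁻¹)) α⁻¹α≡1
        ββ⁻¹≡1 = ≡ₚ-trans (≡⇒≡ₚ (ℤₚ.*-comm β β⁻¹)) β⁻¹β≡1
    in automorphism (scaleᵗ α β α≢0 β≢0) (scaleᵗ α⁻¹ β⁻¹ (unit≢0 α⁻¹ α α⁻¹α≡1) (unit≢0 β⁻¹ β β⁻¹β≡1))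
      (λ (x , y , z) → cancel α α⁻¹ x αα⁻¹≡1 , cancel β β⁻¹ y ββ⁻¹≡1 , cancel₂ α α⁻¹ β β⁻¹ z αα⁻¹≡1 ββ⁻¹≡1)
      (λ (x , y , z) → cancel α⁻¹ α x α⁻¹α≡1 , cancel β⁻¹ β y β⁻¹β≡1 , cancel₂ α⁻¹ α β⁻¹ β z α⁻¹α≡1 β⁻¹β≡1)
    where
    unit≢0 : ∀ m n → m ℤ.* n ≡ₚ 1ℤ → ¬ m ≡ₚ 0ℤ
    unit≢0 m n mn≡1 m≡0 = 1≢0 (combine (ℤ.- 1ℤ ⊛ mn≡1 ⊕ n ⊛ m≡0) (solve (m ∷ n ∷ [])))
    cancel : ∀ m n x → m ℤ.* n ≡ₚ 1ℤ → m ℤ.* (n ℤ.* x) ≡ₚ x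
    cancel m n x e = combine (x ⊛ e) (solve (m ∷ n ∷ x ∷ []))
    cancel₂ : ∀ m n m′ n′ z → m ℤ.* n ≡ₚ 1ℤ → m′ ℤ.* n′ ≡ₚ 1ℤ → m ℤ.* m′ ℤ.* (n ℤ.* n′ ℤ.* z) ≡ₚ z
    cancel₂ m n m′ n′ z e e′ =
      combine (m′ ℤ.* n′ ℤ.* z ⊛ e ⊕ z ⊛ e′) (solve (m ∷ n ∷ m′ ∷ n′ ∷ z ∷ []))

  open Group (Aut Γ) using () renaming (_∙_ to _then_; _⁻¹ to _⁻¹ᵃ)
  open module Permutation (φ : Automorphism Γ) = Automorphism φ
    using (to; from; to-cong; from-cong; strictlyInverseˡ; strictlyInverseʳ; Adj-⇔)

  -- `Joined` with equality allowed, hence an equivalence relation. Its classes are the cosets ⟨a⟩g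
  -- and ⟨b⟩g: the flags with a common point (y , z), or with a common line (x , w).
  Line : Kind → Rel Triple 0ℓ
  Line 𝐚 (x , y , z) (x′ , y′ , z′) = y ≡ₚ y′ × z ≡ₚ z′
  Line 𝐛 (x , y , z) (x′ , y′ , z′) = x ≡ₚ x′ × z ℤ.+ x ℤ.* y ≡ₚ z′ ℤ.+ x′ ℤ.* y′

  line : ∀ k {s t} → Joined k s t → Line k s t
  line 𝐚 = proj₂
  line 𝐛 = proj₂

  Line-sym : ∀ k {s t} → Line k s t → Line k t s
  Line-sym 𝐚 (≡₁ , ≡₂) = ≡ₚ-sym ≡₁ , ≡ₚ-sym ≡₂
  Line-sym 𝐛 (≡₁ , ≡₂) = ≡ₚ-sym ≡₁ , ≡ₚ-sym ≡₂

  Line-trans : ∀ k {s t u} → Line k s t → Line k t u → Line k s u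
  Line-trans 𝐚 (≡₁ , ≡₂) (≡₁′ , ≡₂′) = ≡ₚ-trans ≡₁ ≡₁′ , ≡ₚ-trans ≡₂ ≡₂′
  Line-trans 𝐛 (≡₁ , ≡₂) (≡₁′ , ≡₂′) = ≡ₚ-trans ≡₁ ≡₁′ , ≡ₚ-trans ≡₂ ≡₂′

  equal-or-joined : ∀ k {s t} → Line k s t → s ≋ t ⊎ Joined k s t
  equal-or-joined 𝐚 {x , _} {x′ , _} (y≡ , z≡) with x ≟ₚ x′
  ... | yes x≡ = inj₁ (x≡ , y≡ , z≡)
  ... | no x≢  = inj₂ (x≢ , y≡ , z≡)
  equal-or-joined 𝐛 {x , y , z} {x′ , y′ , z′} (x≡ , w≡) = [ equal , distinct ]′ (Dec.toSum (y ≟ₚ y′))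
    where
    equal : y ≡ₚ y′ → (x , y , z) ≋ (x′ , y′ , z′) ⊎ Joined 𝐛 (x , y , z) (x′ , y′ , z′)
    equal y≡ = inj₁ (x≡ , y≡ ,
      combine (1ℤ ⊛ w≡ ⊕ ℤ.- y ⊛ x≡ ⊕ ℤ.- x′ ⊛ y≡) (solve (x ∷ y ∷ z ∷ x′ ∷ y′ ∷ z′ ∷ [])))
    distinct : ¬ y ≡ₚ y′ → (x , y , z) ≋ (x′ , y′ , z′) ⊎ Joined 𝐛 (x , y , z) (x′ , y′ , z′)
    distinct y≢ = inj₂ (y≢ , x≡ , w≡)

  Joined-trans : ∀ k s {t u} → Joined k s t → Joined k s u → t ≋ u ⊎ Joined k t u
  Joined-trans k s st su = equal-or-joined k (Line-trans k (Line-sym k (line k st)) (line k su))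

  adjacent : ∀ {u v} → IsDistance Γ u v 1 → Adj u v
  adjacent {u} {v} (step {v = w} uw (here w≈v) , _) = proj₁ (Graph.Adj-resp-≈ Γ) {u} {w} {v} w≈v uw

  -- Two consecutive edges of the same kind stay in one clique, so their ends are equal or adjacent.
  -- On a path realising distance 2 the kinds therefore alternate.
  path : ∀ {u v} → IsDistance Γ u v 2 →
    ∃[ m ] ∃[ k ] Joined k (eval u) (eval m) × Joined (opposite k) (eval m) (eval v)
  path {u} {v} (step {v = m} um (step {v = w} mw (here w≈v)) , least) =
    let k , j  = adjacent⇒joined um
        l , j′ = adjacent⇒joined mw
    in m , k , j , turn k l j (Joined-resp l _ _ _ _ (≡⇒≋ ≡.refl) (eval-cong w≈v) j′)
    where
    same : ∀ k → Joined k (eval u) (eval m) → ¬ Joined k (eval m) (eval v)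
    same k um mv = [ (λ u≋v → 2≰0 (least (here (eval-injective u≋v)))) ,
                     (λ uv → 2≰1 (least (step (joined⇒adjacent k uv) (here refl)))) ]′
                   (Joined-trans k (eval m) (Joined-sym k (eval u) (eval m) um) mv)
      where
      2≰0 : ¬ 2 ℕ.≤ 0
      2≰0 ()
      2≰1 : ¬ 2 ℕ.≤ 1
      2≰1 (ℕ.s≤s ())
    turn : ∀ k l → Joined k (eval u) (eval m) → Joined l (eval m) (eval v) →
      Joined (opposite k) (eval m) (eval v)
    turn 𝐚 𝐚 j j′ = contradiction j′ (same 𝐚 j)
    turn 𝐚 𝐛 j j′ = j′
    turn 𝐛 𝐚 j j′ = j′
    turn 𝐛 𝐛 j j′ = contradiction j′ (same 𝐛 j)

  -- The scaling fixes ε and the right translation then carries ε to `u`; the factors `i` and `j`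
  -- remain free to place a second vertex.
  module ScaleRight (i j : ℤ) (i≢0 : ¬ i ≡ₚ 0ℤ) (j≢0 : ¬ j ≡ₚ 0ℤ) (u : Word Generator) where
    scaleRight : Automorphism Γ
    scaleRight = scale i j i≢0 j≢0 then R G connectionSet u

    eval-scaleRight : ∀ g → eval (to scaleRight g) ≋
      (i ℤ.* X g ℤ.+ X u , j ℤ.* Y g ℤ.+ Y u , i ℤ.* j ℤ.* Z g ℤ.+ Z u ℤ.+ ℤ.- (j ℤ.* Y g ℤ.* X u))
    eval-scaleRight g =
      let x , y , z = eval-word-of (i ℤ.* X g , j ℤ.* Y g , i ℤ.* j ℤ.* Z g)
          r = λ {x} → ≡⇒≡ₚ {x} ≡.refl
      in +-congₚ x r , +-congₚ y r , +-congₚ (+-congₚ z r) (neg-congₚ (*-congₚ y r))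

    scaleRight-≈ : ∀ g {v} →
      (i ℤ.* X g ℤ.+ X u , j ℤ.* Y g ℤ.+ Y u , i ℤ.* j ℤ.* Z g ℤ.+ Z u ℤ.+ ℤ.- (j ℤ.* Y g ℤ.* X u)) ≋ eval v →
      to scaleRight g ≈ v
    scaleRight-≈ g e = eval-injective (Setoid.trans ≋-setoid {eval (to scaleRight g)} (eval-scaleRight g) e)

    scaleRight-ε : to scaleRight ε ≈ u
    scaleRight-ε = scaleRight-≈ ε (lemma₁ i (X u) , lemma₁ j (Y u) , lemma₂ i j (Z u) (X u))
      where
      lemma₁ : ∀ m x → m ℤ.* 0ℤ ℤ.+ x ≡ₚ x
      lemma₁ m x = ≡⇒≡ₚ (solve (m ∷ x ∷ []))
      lemma₂ : ∀ i j z x → i ℤ.* j ℤ.* 0ℤ ℤ.+ z ℤ.+ ℤ.- (j ℤ.* 0ℤ ℤ.* x) ≡ₚ z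
      lemma₂ i j z x = ≡⇒≡ₚ (solve (i ∷ j ∷ z ∷ x ∷ []))

  swap-≈ : ∀ g h → (Y g , X g , ℤ.- (Z g ℤ.+ X g ℤ.* Y g)) ≡ eval h → to swap g ≈ h
  swap-≈ g h e = eval-injective (≡.subst (eval (to swap g) ≋_) e (eval-word-of _))

  difference≢0 : ∀ {x y} → ¬ x ≡ₚ y → ¬ y ℤ.- x ≡ₚ 0ℤ
  difference≢0 {x} {y} x≢y e = x≢y (combine (ℤ.- 1ℤ ⊛ e) (solve (x ∷ y ∷ [])))

  -- The base edge ε  -  a is stretched by the difference of the x-coordinates. For kind `𝐛` the
  -- swap first turns it into ε  -  b, and the difference of the y-coordinates is used.
  edge-orbit : ∀ k {u v} → Joined k (eval u) (eval v) → ∃[ φ ] (to φ ε ≈ u × to φ a ≈ v)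
  edge-orbit 𝐚 {u} {v} (x≢ , y≡ , z≡) = scaleRight , scaleRight-ε ,
    scaleRight-≈ a (lemma₁ (X u) (X v) , lemma₂ (Y u) (Y v) y≡ , lemma₃ (X u) (X v) (Z u) (Z v) z≡)
    where
    open ScaleRight (X v ℤ.- X u) 1ℤ (difference≢0 x≢) 1≢0 u
    lemma₁ : ∀ x x′ → (x′ ℤ.- x) ℤ.* 1ℤ ℤ.+ x ≡ₚ x′
    lemma₁ x x′ = ≡⇒≡ₚ (solve (x ∷ x′ ∷ []))
    lemma₂ : ∀ y y′ → y ≡ₚ y′ → 1ℤ ℤ.* 0ℤ ℤ.+ y ≡ₚ y′
    lemma₂ y y′ e = combine (1ℤ ⊛ e) (solve (y ∷ y′ ∷ []))
    lemma₃ : ∀ x x′ z z′ → z ≡ₚ z′ → (x′ ℤ.- x) ℤ.* 1ℤ ℤ.* 0ℤ ℤ.+ z ℤ.+ ℤ.- (1ℤ ℤ.* 0ℤ ℤ.* x) ≡ₚ z′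
    lemma₃ x x′ z z′ e = combine (1ℤ ⊛ e) (solve (x ∷ x′ ∷ z ∷ z′ ∷ []))
  edge-orbit 𝐛 {u} {v} (y≢ , x≡ , w≡) = swap then scaleRight ,
    trans (to-cong scaleRight (swap-≈ ε ε ≡.refl)) scaleRight-ε ,
    trans (to-cong scaleRight (swap-≈ a b ≡.refl)) (scaleRight-≈ b
      (lemma₁ (X u) (X v) x≡ , lemma₂ (Y u) (Y v) , lemma₃ (X u) (Y u) (Z u) (X v) (Y v) (Z v) x≡ w≡))
    where
    open ScaleRight 1ℤ (Y v ℤ.- Y u) 1≢0 (difference≢0 y≢) u
    lemma₁ : ∀ x x′ → x ≡ₚ x′ → 1ℤ ℤ.* 0ℤ ℤ.+ x ≡ₚ x′
    lemma₁ x x′ e = combine (1ℤ ⊛ e) (solve (x ∷ x′ ∷ []))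
    lemma₂ : ∀ y y′ → (y′ ℤ.- y) ℤ.* 1ℤ ℤ.+ y ≡ₚ y′
    lemma₂ y y′ = ≡⇒≡ₚ (solve (y ∷ y′ ∷ []))
    lemma₃ : ∀ x y z x′ y′ z′ → x ≡ₚ x′ → z ℤ.+ x ℤ.* y ≡ₚ z′ ℤ.+ x′ ℤ.* y′ →
      1ℤ ℤ.* (y′ ℤ.- y) ℤ.* 0ℤ ℤ.+ z ℤ.+ ℤ.- ((y′ ℤ.- y) ℤ.* 1ℤ ℤ.* x) ≡ₚ z′
    lemma₃ x y z x′ y′ z′ x≡ w≡ = combine (1ℤ ⊛ w≡ ⊕ ℤ.- y′ ⊛ x≡) (solve (x ∷ y ∷ z ∷ x′ ∷ y′ ∷ z′ ∷ []))

  -- The base path is ε  -  a  -  b a; the swap turns it into ε  -  b  -  a b for the other order of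
  -- kinds. The two factors are the x- and y-differences along the two edges of the given path.
  path-orbit : ∀ k {u m v} → Joined k (eval u) (eval m) → Joined (opposite k) (eval m) (eval v) →
    ∃[ φ ] (to φ ε ≈ u × to φ (b ∙ a) ≈ v)
  path-orbit 𝐚 {u} {m} {v} (x≢ , y≡ , z≡) (y≢ , x≡ , w≡) = scaleRight , scaleRight-ε ,
    scaleRight-≈ (b ∙ a)
      (lemma₁ (X u) (X m) (X v) x≡ , lemma₂ (Y u) (Y m) (Y v) y≡ ,
       lemma₃ (X u) (Y u) (Z u) (X m) (Y m) (Z m) (X v) (Y v) (Z v) y≡ z≡ x≡ w≡)
    where
    open ScaleRight (X m ℤ.- X u) (Y v ℤ.- Y m) (difference≢0 x≢) (difference≢0 y≢) u
    lemma₁ : ∀ x x′ x″ → x′ ≡ₚ x″ → (x′ ℤ.- x) ℤ.* 1ℤ ℤ.+ x ≡ₚ x″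
    lemma₁ x x′ x″ e = combine (1ℤ ⊛ e) (solve (x ∷ x′ ∷ x″ ∷ []))
    lemma₂ : ∀ y y′ y″ → y ≡ₚ y′ → (y″ ℤ.- y′) ℤ.* 1ℤ ℤ.+ y ≡ₚ y″
    lemma₂ y y′ y″ e = combine (1ℤ ⊛ e) (solve (y ∷ y′ ∷ y″ ∷ []))
    lemma₃ : ∀ x y z x′ y′ z′ x″ y″ z″ → y ≡ₚ y′ → z ≡ₚ z′ → x′ ≡ₚ x″ →
      z′ ℤ.+ x′ ℤ.* y′ ≡ₚ z″ ℤ.+ x″ ℤ.* y″ →
      (x′ ℤ.- x) ℤ.* (y″ ℤ.- y′) ℤ.* ℤ.-1ℤ ℤ.+ z ℤ.+ ℤ.- ((y″ ℤ.- y′) ℤ.* 1ℤ ℤ.* x) ≡ₚ z″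
    lemma₃ x y z x′ y′ z′ x″ y″ z″ y≡ z≡ x≡ w≡ = combine (1ℤ ⊛ w≡ ⊕ 1ℤ ⊛ z≡ ⊕ ℤ.- y″ ⊛ x≡)
      (solve (x ∷ y ∷ z ∷ x′ ∷ y′ ∷ z′ ∷ x″ ∷ y″ ∷ z″ ∷ []))
  path-orbit 𝐛 {u} {m} {v} (y≢ , x≡ , w≡) (x≢ , y≡ , z≡) = swap then scaleRight ,
    trans (to-cong scaleRight (swap-≈ ε ε ≡.refl)) scaleRight-ε ,
    trans (to-cong scaleRight (swap-≈ (b ∙ a) (a ∙ b) ≡.refl)) (scaleRight-≈ (a ∙ b)
      (lemma₁ (X u) (X m) (X v) x≡ , lemma₂ (Y u) (Y m) (Y v) y≡ ,
       lemma₃ (X u) (Y u) (Z u) (X m) (Y m) (Z m) (X v) (Y v) (Z v) x≡ w≡ z≡))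
    where
    open ScaleRight (X v ℤ.- X m) (Y m ℤ.- Y u) (difference≢0 x≢) (difference≢0 y≢) u
    lemma₁ : ∀ x x′ x″ → x ≡ₚ x′ → (x″ ℤ.- x′) ℤ.* 1ℤ ℤ.+ x ≡ₚ x″
    lemma₁ x x′ x″ e = combine (1ℤ ⊛ e) (solve (x ∷ x′ ∷ x″ ∷ []))
    lemma₂ : ∀ y y′ y″ → y′ ≡ₚ y″ → (y′ ℤ.- y) ℤ.* 1ℤ ℤ.+ y ≡ₚ y″
    lemma₂ y y′ y″ e = combine (1ℤ ⊛ e) (solve (y ∷ y′ ∷ y″ ∷ []))
    lemma₃ : ∀ x y z x′ y′ z′ x″ y″ z″ → x ≡ₚ x′ → z ℤ.+ x ℤ.* y ≡ₚ z′ ℤ.+ x′ ℤ.* y′ → z′ ≡ₚ z″ →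
      (x″ ℤ.- x′) ℤ.* (y′ ℤ.- y) ℤ.* 0ℤ ℤ.+ z ℤ.+ ℤ.- ((y′ ℤ.- y) ℤ.* 1ℤ ℤ.* x) ≡ₚ z″
    lemma₃ x y z x′ y′ z′ x″ y″ z″ x≡ w≡ z≡ = combine (1ℤ ⊛ w≡ ⊕ 1ℤ ⊛ z≡ ⊕ ℤ.- y′ ⊛ x≡)
      (solve (x ∷ y ∷ z ∷ x′ ∷ y′ ∷ z′ ∷ x″ ∷ y″ ∷ z″ ∷ []))

  via-representative : ∀ {r s u v x y} →
    ∃[ φ ] (to φ r ≈ u × to φ s ≈ v) → ∃[ φ ] (to φ r ≈ x × to φ s ≈ y) →
    ∃[ φ ] (to φ u ≈ x × to φ v ≈ y)
  via-representative (φ , ru , sv) (ψ , rx , sy) = (φ ⁻¹ᵃ) then ψ ,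
    trans (to-cong ψ (Permutation.inverseʳ φ (sym ru))) rx , trans (to-cong ψ (Permutation.inverseʳ φ (sym sv))) sy

  2-distance-transitive : t-DistanceTransitive Γ 2
  2-distance-transitive 0 () _
  2-distance-transitive 1 _ _ u v x y duv dxy =
    via-representative (orbit duv) (orbit dxy)
    where
    orbit : ∀ {u v} → IsDistance Γ u v 1 → ∃[ φ ] (to φ ε ≈ u × to φ a ≈ v)
    orbit {u} {v} d = let k , j = adjacent⇒joined {u} {v} (adjacent d) in edge-orbit k j
  2-distance-transitive 2 _ _ u v x y duv dxy =
    via-representative (orbit duv) (orbit dxy)
    where
    orbit : ∀ {u v} → IsDistance Γ u v 2 → ∃[ φ ] (to φ ε ≈ u × to φ (b ∙ a) ≈ v)
    orbit d = let m , k , j , j′ = path d in path-orbit k j j′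
  2-distance-transitive (suc (suc (suc _))) _ (ℕ.s≤s (ℕ.s≤s ()))

  -- Normality

  _·_ : Kind → Kind → Kind
  𝐚 · l = l
  𝐛 · l = opposite l

  ·-cancelˡ : ∀ k l m → k · l ≡ k · m → l ≡ m
  ·-cancelˡ 𝐚 _ _ e = e
  ·-cancelˡ 𝐛 𝐚 𝐚 _ = ≡.refl
  ·-cancelˡ 𝐛 𝐛 𝐛 _ = ≡.refl

  joined-kind-unique : ∀ k l {s t} → Joined k s t → Joined l s t → k ≡ l
  joined-kind-unique 𝐚 𝐚 _ _ = ≡.refl
  joined-kind-unique 𝐚 𝐛 (x≢ , _) (_ , x≡ , _) = contradiction x≡ x≢
  joined-kind-unique 𝐛 𝐚 (y≢ , _) (_ , y≡ , _) = contradiction y≡ y≢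
  joined-kind-unique 𝐛 𝐛 _ _ = ≡.refl

  -- One edge changes x alone of x and y, the other y alone, so the far ends differ in both; equal
  -- or adjacent vertices agree in at least one.
  mixed⇒apart : ∀ k {s t u} → Joined k s t → Joined (opposite k) s u →
    ¬ t ≋ u × (∀ l → ¬ Joined l t u)
  mixed⇒apart k {s} {t} {u} st su = (λ (x , y , _) → x-apart k st su x) , λ
    { 𝐚 (_ , y , _) → y-apart k st su y
    ; 𝐛 (_ , x , _) → x-apart k st su x }
    where
    x-apart : ∀ k → Joined k s t → Joined (opposite k) s u → ¬ proj₁ t ≡ₚ proj₁ u
    x-apart 𝐚 (x≢ , _) (_ , x≡ , _) e = x≢ (≡ₚ-trans x≡ (≡ₚ-sym e))
    x-apart 𝐛 (_ , x≡ , _) (x≢ , _) e = x≢ (≡ₚ-trans x≡ e)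
    y-apart : ∀ k → Joined k s t → Joined (opposite k) s u → ¬ proj₁ (proj₂ t) ≡ₚ proj₁ (proj₂ u)
    y-apart 𝐚 (_ , y≡ , _) (y≢ , _) e = y≢ (≡ₚ-trans y≡ e)
    y-apart 𝐛 (y≢ , _) (_ , y≡ , _) e = y≢ (≡ₚ-trans y≡ (≡ₚ-sym e))

  -- By `mixed⇒apart`, edges of different kinds at `s` have far ends that neither coincide nor are
  -- adjacent, so the two kinds here must agree.
  triangle : ∀ k l {s t u} → Joined k s t → Joined l s u → t ≋ u ⊎ ∃[ m ] Joined m t u → Joined k s u
  triangle 𝐚 𝐚 _ su _ = su
  triangle 𝐛 𝐛 _ su _ = su
  triangle 𝐚 𝐛 st su (inj₁ e)       = contradiction e (proj₁ (mixed⇒apart 𝐚 st su))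
  triangle 𝐚 𝐛 st su (inj₂ (m , j)) = contradiction j (proj₂ (mixed⇒apart 𝐚 st su) m)
  triangle 𝐛 𝐚 st su (inj₁ e)       = contradiction e (proj₁ (mixed⇒apart 𝐛 st su))
  triangle 𝐛 𝐚 st su (inj₂ (m , j)) = contradiction j (proj₂ (mixed⇒apart 𝐛 st su) m)

  joined-image : ∀ φ k {u v} → Joined k (eval u) (eval v) → ∃[ l ] Joined l (eval (to φ u)) (eval (to φ v))
  joined-image φ k {u} {v} j = adjacent⇒joined {to φ u} {to φ v}
    (Equivalence.to (Adj-⇔ φ {u} {v}) (joined⇒adjacent k {u} {v} j))

  joined-preimage : ∀ φ k {u v} → Joined k (eval (to φ u)) (eval (to φ v)) → ∃[ l ] Joined l (eval u) (eval v)
  joined-preimage φ k {u} {v} j = adjacent⇒joined {u} {v}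
    (Equivalence.from (Adj-⇔ φ {u} {v}) (joined⇒adjacent k {to φ u} {to φ v} j))

  to-injective : ∀ φ {u v} → to φ u ≈ to φ v → u ≈ v
  to-injective φ {u} {v} e = trans (sym (strictlyInverseʳ φ u)) (trans (from-cong φ e) (strictlyInverseʳ φ v))

  -- Under `_·_` the kinds form the group of order two with identity `𝐚`: at `u` the automorphism
  -- keeps the kinds if `l` is `𝐚` and exchanges them if `l` is `𝐛`.
  ActsAt : Automorphism Γ → Kind → Word Generator → Set
  ActsAt φ l u = ∀ k {v} → Joined k (eval u) (eval v) → Joined (k · l) (eval (to φ u)) (eval (to φ v))

  -- The edge u  -  a u serves as reference and `l` is the kind of its image. Edges of kind `𝐚` at u
  -- lie in a clique with it, and so do their images. Were the image of a `𝐛`-edge u  -  v also of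
  -- kind `l`, the images of a u and v would be equal or adjacent, hence so would a u and v.
  acts : ∀ φ u → ∃[ l ] ActsAt φ l u
  acts φ u = l , action
    where
    u-au : Joined 𝐚 (eval u) (eval (a ∙ u))
    u-au = lemma₁ (X u) , ≡⇒≡ₚ (≡.sym (ℤₚ.+-identityˡ (Y u))) , lemma₂ (X u) (Z u)
      where
      lemma₁ : ∀ x → ¬ x ≡ₚ 1ℤ ℤ.+ x
      lemma₁ x e = 1≢0 (combine (ℤ.- 1ℤ ⊛ e) (solve (x ∷ [])))
      lemma₂ : ∀ x z → z ≡ₚ 0ℤ ℤ.+ z ℤ.+ ℤ.- (0ℤ ℤ.* x)
      lemma₂ x z = ≡⇒≡ₚ (solve (x ∷ z ∷ []))
    l : Kind
    l = proj₁ (joined-image φ 𝐚 {u} {a ∙ u} u-au)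
    φu-φau : Joined l (eval (to φ u)) (eval (to φ (a ∙ u)))
    φu-φau = proj₂ (joined-image φ 𝐚 {u} {a ∙ u} u-au)
    clash : ∀ k {v} → Joined k (eval (to φ u)) (eval (to φ (a ∙ u))) → Joined k (eval (to φ u)) (eval (to φ v)) →
      ¬ Joined 𝐛 (eval u) (eval v)
    clash k {v} i j uv =
      let au≉v , no-edge = mixed⇒apart 𝐚 u-au uv
      in [ (λ e → au≉v (eval-cong (to-injective φ (eval-injective e))))
         , (λ m → let l , n = joined-preimage φ k {a ∙ u} {v} m in no-edge l n)
         ]′ (Joined-trans k (eval (to φ u)) i j)
    other : ∀ k l {v} → Joined l (eval (to φ u)) (eval (to φ (a ∙ u))) → Joined 𝐛 (eval u) (eval v) →
      Joined k (eval (to φ u)) (eval (to φ v)) → Joined (opposite l) (eval (to φ u)) (eval (to φ v))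
    other 𝐚 𝐛 _ _ j = j
    other 𝐛 𝐚 _ _ j = j
    other 𝐚 𝐚 {v} i uv j = contradiction uv (clash 𝐚 {v} i j)
    other 𝐛 𝐛 {v} i uv j = contradiction uv (clash 𝐛 {v} i j)
    action : ActsAt φ l u
    action 𝐚 {v} uv =
      let k , j = joined-image φ 𝐚 {u} {v} uv
      in triangle l k φu-φau j (Sum.map
           (λ e → eval-cong (to-cong φ (eval-injective {a ∙ u} {v} e)))
           (joined-image φ 𝐚 {a ∙ u} {v})
           (Joined-trans 𝐚 (eval u) u-au uv))
    action 𝐛 {v} uv = let k , j = joined-image φ 𝐛 {u} {v} uv in other k l {v} φu-φau uv j

  -- Six line moves lead from the origin to any triple; a move may be trivial, which is why `P` must
  -- respect congruence.
  connected : (P : Triple → Set) → (∀ {s t} → s ≋ t → P s → P t) →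
    (∀ k {s t} → Joined k s t → P s → P t) → P (0ℤ , 0ℤ , 0ℤ) → ∀ t → P t
  connected P resp move origin (x , y , z) =
    -- Each `along` names the start of its move, so the route reads from the bottom up. The detour
    -- through x = 1 raises z from 0 to w at x = y = 0; the last two moves set x and then y, keeping
    -- w.
    along 𝐛 (x , 0ℤ , w) (≡⇒≡ₚ ≡.refl , ≡⇒≡ₚ (lemma₃ x w)) (
    along 𝐚 (0ℤ , 0ℤ , w) (≡⇒≡ₚ ≡.refl , ≡⇒≡ₚ ≡.refl) (
    along 𝐛 (0ℤ , ℤ.- w , w) (≡⇒≡ₚ ≡.refl , ≡⇒≡ₚ (lemma₂ w)) (
    along 𝐚 (1ℤ , ℤ.- w , w) (≡⇒≡ₚ ≡.refl , ≡⇒≡ₚ ≡.refl) (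
    along 𝐛 (1ℤ , 0ℤ , 0ℤ) (≡⇒≡ₚ ≡.refl , ≡⇒≡ₚ (lemma₁ w)) (
    along 𝐚 (0ℤ , 0ℤ , 0ℤ) (≡⇒≡ₚ ≡.refl , ≡⇒≡ₚ ≡.refl) origin)))))
    where
    w : ℤ
    w = z ℤ.+ x ℤ.* y
    along : ∀ k s {t} → Line k s t → P s → P t
    along k s st Ps = [ (λ e → resp e Ps) , (λ j → move k j Ps) ]′ (equal-or-joined k st)
    lemma₁ : ∀ w → 0ℤ ℤ.+ 1ℤ ℤ.* 0ℤ ≡ w ℤ.+ 1ℤ ℤ.* ℤ.- w
    lemma₁ w = solve (w ∷ [])
    lemma₂ : ∀ w → w ℤ.+ 0ℤ ℤ.* ℤ.- w ≡ w ℤ.+ 0ℤ ℤ.* 0ℤ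
    lemma₂ w = solve (w ∷ [])
    lemma₃ : ∀ x w → w ℤ.+ x ℤ.* 0ℤ ≡ w
    lemma₃ x w = solve (x ∷ w ∷ [])

  -- The image of an edge has a single kind, so the local types at its two ends agree; connectedness
  -- spreads the type found at ε.
  acts-uniformly : ∀ φ → ∃[ l ] (∀ u → ActsAt φ l u)
  acts-uniformly φ = l , λ u → connected P resp move origin (eval u) u (≡⇒≋ ≡.refl)
    where
    l : Kind
    l = proj₁ (acts φ ε)
    P : Triple → Set
    P t = ∀ u → t ≋ eval u → ActsAt φ l u
    resp : ∀ {s t} → s ≋ t → P s → P t
    resp {s} {t} s≋t Ps u t≋u = Ps u (Setoid.trans ≋-setoid {s} {t} {eval u} s≋t t≋u)
    origin : P (0ℤ , 0ℤ , 0ℤ)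
    origin u e k {v} uv = Joined-resp (k · l) _ _ _ _
      (eval-cong (to-cong φ (eval-injective {ε} {u} e))) (≡⇒≋ ≡.refl)
      (proj₂ (acts φ ε) k {v} (Joined-resp k _ _ _ _
        (Setoid.sym ≋-setoid {eval ε} {eval u} e) (≡⇒≋ {eval v} ≡.refl) uv))
    move : ∀ k {s t} → Joined k s t → P s → P t
    move k {s} {t} st Ps v t≋v k′ {v′} j =
      let l′ , act = acts φ v
      in ≡.subst (λ m → Joined (k′ · m) (eval (to φ v)) (eval (to φ v′))) (same l′ act) (act k′ {v′} j)
      where
      u : Word Generator
      u = word-of s
      uv : Joined k (eval u) (eval v)
      uv = Joined-resp k s (eval u) t (eval v) (Setoid.sym ≋-setoid {eval u} {s} (eval-word-of s)) t≋v st
      same : ∀ l′ → ActsAt φ l′ v → l′ ≡ l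
      -- The image of the edge has kind `k · l′` when seen from v and `k · l` when seen from u.
      same l′ act = ·-cancelˡ k l′ l (joined-kind-unique _ _
        (Joined-sym (k · l′) _ _ (act k {u} (Joined-sym k _ _ uv)))
        (Ps u (Setoid.sym ≋-setoid {eval u} {s} (eval-word-of s)) k {v} uv))

  KindPreserving : Automorphism Γ → Set
  KindPreserving φ = ∀ k {u v} → Joined k (eval u) (eval v) → Joined k (eval (to φ u)) (eval (to φ v))

  preserving-or-swapping : ∀ φ → KindPreserving φ ⊎ KindPreserving (φ then swap)
  preserving-or-swapping φ = let l , act = acts-uniformly φ in by-kind l act
    where
    by-kind : ∀ l → (∀ u → ActsAt φ l u) → KindPreserving φ ⊎ KindPreserving (φ then swap)
    by-kind 𝐚 act = inj₁ λ
      { 𝐚 {u} {v} j → act u 𝐚 {v} j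
      ; 𝐛 {u} {v} j → act u 𝐛 {v} j }
    by-kind 𝐛 act = inj₂ λ
      { 𝐚 {u} {v} j → swapped 𝐛 (to φ u) (to φ v) (act u 𝐚 {v} j)
      ; 𝐛 {u} {v} j → swapped 𝐚 (to φ u) (to φ v) (act u 𝐛 {v} j) }
      where
      swapped : ∀ k u v → Joined k (eval u) (eval v) →
        Joined (opposite k) (eval (to swap u)) (eval (to swap v))
      swapped k u v j = Joined-resp (opposite k) _ _ _ _
        (Setoid.sym ≋-setoid {eval (to swap u)} (eval-word-of _))
        (Setoid.sym ≋-setoid {eval (to swap v)} (eval-word-of _))
        (proj₂ (JoinedMap.map-joined swapᵗ k (eval u) (eval v) j))

  -- Whatever kind the inverse gives to an edge, `φ` carries that kind back to the original edge,
  -- whose kind is unique.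
  KindPreserving-⁻¹ : ∀ φ → KindPreserving φ → KindPreserving (φ ⁻¹ᵃ)
  KindPreserving-⁻¹ φ preserves k {u} {v} uv =
    let l , j = joined-image (φ ⁻¹ᵃ) k {u} {v} uv
    in ≡.subst (λ m → Joined m (eval (from φ u)) (eval (from φ v)))
      (joined-kind-unique l k
        (Joined-resp l _ _ _ _ (eval-cong (strictlyInverseˡ φ u)) (eval-cong (strictlyInverseˡ φ v))
          (preserves l {from φ u} {from φ v} j))
        uv) j

  -- With K z = k 0 z the equation becomes K (z + x y) = K z + (f x − f 0) (g y − g 0); setting
  -- x = 1 or y = 1 shows that f − f 0 and g − g 0 are additive.
  module FunctionalEquation (f g : ℤ → ℤ) (h k : ℤ → ℤ → ℤ)
    (equation : ∀ x y z w → w ≡ₚ z ℤ.+ x ℤ.* y → h y z ℤ.+ f x ℤ.* g y ≡ₚ k x w)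
    (f1≢f0 : ¬ f 1ℤ ≡ₚ f 0ℤ) (g1≢g0 : ¬ g 1ℤ ≡ₚ g 0ℤ) where

    F G′ K : ℤ → ℤ
    F x = f x ℤ.- f 0ℤ
    G′ y = g y ℤ.- g 0ℤ
    K = k 0ℤ

    -- A second difference: the instances at (x , y) and (0 , y) share `h y z`, those at (x , 0) and
    -- (0 , 0) share `h 0ℤ w`, and the first of each pair shares `k x w`. All of these cancel.
    K-increment : ∀ x y z w → w ≡ₚ z ℤ.+ x ℤ.* y → K w ≡ₚ K z ℤ.+ F x ℤ.* G′ y
    K-increment x y z w w≡ = lemma (f x) (f 0ℤ) (g y) (g 0ℤ) (h y z) (h 0ℤ w) (k x w) (K z) (K w)
      (equation x y z w w≡)
      (equation 0ℤ y z z (≡⇒≡ₚ (lemma₁ y z)))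
      (equation x 0ℤ w w (≡⇒≡ₚ (lemma₂ x w)))
      (equation 0ℤ 0ℤ w w (≡⇒≡ₚ (lemma₁ 0ℤ w)))
      where
      lemma₁ : ∀ y z → z ≡ z ℤ.+ 0ℤ ℤ.* y
      lemma₁ y z = solve (y ∷ z ∷ [])
      lemma₂ : ∀ x w → w ≡ w ℤ.+ x ℤ.* 0ℤ
      lemma₂ x w = solve (x ∷ w ∷ [])
      lemma : ∀ fx f0 gy g0 hyz h0w kxw Kz Kw → hyz ℤ.+ fx ℤ.* gy ≡ₚ kxw → hyz ℤ.+ f0 ℤ.* gy ≡ₚ Kz →
        h0w ℤ.+ fx ℤ.* g0 ≡ₚ kxw → h0w ℤ.+ f0 ℤ.* g0 ≡ₚ Kw →
        Kw ≡ₚ Kz ℤ.+ (fx ℤ.- f0) ℤ.* (gy ℤ.- g0)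
      lemma fx f0 gy g0 hyz h0w kxw Kz Kw e₁ e₂ e₃ e₄ =
        combine (ℤ.- 1ℤ ⊛ e₁ ⊕ 1ℤ ⊛ e₂ ⊕ 1ℤ ⊛ e₃ ⊕ ℤ.- 1ℤ ⊛ e₄)
          (solve (fx ∷ f0 ∷ gy ∷ g0 ∷ hyz ∷ h0w ∷ kxw ∷ Kz ∷ Kw ∷ []))

    -- With y = 1, `K` is taken from 0 to x + d both directly and by way of x; comparing the
    -- increments leaves the nonzero factor `G′ 1ℤ` to cancel.
    f-shift : ∀ x d → f (x ℤ.+ d) ≡ₚ f x ℤ.+ F d
    f-shift x d = *-cancelˡₚ (difference≢0 (λ e → g1≢g0 (≡ₚ-sym e)))
      (lemma (f (x ℤ.+ d)) (f x) (f d) (f 0ℤ) (G′ 1ℤ) (K (x ℤ.+ d)) (K x) (K 0ℤ)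
        (K-increment (x ℤ.+ d) 1ℤ 0ℤ (x ℤ.+ d) (≡⇒≡ₚ (lemma₁ (x ℤ.+ d))))
        (K-increment x 1ℤ 0ℤ x (≡⇒≡ₚ (lemma₁ x)))
        (K-increment d 1ℤ x (x ℤ.+ d) (≡⇒≡ₚ (lemma₂ x d))))
      where
      lemma₁ : ∀ x → x ≡ 0ℤ ℤ.+ x ℤ.* 1ℤ
      lemma₁ x = solve (x ∷ [])
      lemma₂ : ∀ x d → x ℤ.+ d ≡ x ℤ.+ d ℤ.* 1ℤ
      lemma₂ x d = solve (x ∷ d ∷ [])
      lemma : ∀ fxd fx fd f0 G1 Kxd Kx K0 → Kxd ≡ₚ K0 ℤ.+ (fxd ℤ.- f0) ℤ.* G1 →
        Kx ≡ₚ K0 ℤ.+ (fx ℤ.- f0) ℤ.* G1 → Kxd ≡ₚ Kx ℤ.+ (fd ℤ.- f0) ℤ.* G1 →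
        G1 ℤ.* fxd ≡ₚ G1 ℤ.* (fx ℤ.+ (fd ℤ.- f0))
      lemma fxd fx fd f0 G1 Kxd Kx K0 e₁ e₂ e₃ =
        combine (ℤ.- 1ℤ ⊛ e₁ ⊕ 1ℤ ⊛ e₂ ⊕ 1ℤ ⊛ e₃) (solve (fxd ∷ fx ∷ fd ∷ f0 ∷ G1 ∷ Kxd ∷ Kx ∷ K0 ∷ []))

    g-shift : ∀ y d → g (y ℤ.+ d) ≡ₚ g y ℤ.+ G′ d
    g-shift y d = *-cancelˡₚ (difference≢0 (λ e → f1≢f0 (≡ₚ-sym e)))
      (lemma (g (y ℤ.+ d)) (g y) (g d) (g 0ℤ) (F 1ℤ) (K (y ℤ.+ d)) (K y) (K 0ℤ)
        (K-increment 1ℤ (y ℤ.+ d) 0ℤ (y ℤ.+ d) (≡⇒≡ₚ (lemma₁ (y ℤ.+ d))))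
        (K-increment 1ℤ y 0ℤ y (≡⇒≡ₚ (lemma₁ y)))
        (K-increment 1ℤ d y (y ℤ.+ d) (≡⇒≡ₚ (lemma₂ y d))))
      where
      lemma₁ : ∀ y → y ≡ 0ℤ ℤ.+ 1ℤ ℤ.* y
      lemma₁ y = solve (y ∷ [])
      lemma₂ : ∀ y d → y ℤ.+ d ≡ y ℤ.+ 1ℤ ℤ.* d
      lemma₂ y d = solve (y ∷ d ∷ [])
      lemma : ∀ gyd gy gd g0 F1 Kyd Ky K0 → Kyd ≡ₚ K0 ℤ.+ F1 ℤ.* (gyd ℤ.- g0) →
        Ky ≡ₚ K0 ℤ.+ F1 ℤ.* (gy ℤ.- g0) → Kyd ≡ₚ Ky ℤ.+ F1 ℤ.* (gd ℤ.- g0) →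
        F1 ℤ.* gyd ≡ₚ F1 ℤ.* (gy ℤ.+ (gd ℤ.- g0))
      lemma gyd gy gd g0 F1 Kyd Ky K0 e₁ e₂ e₃ =
        combine (ℤ.- 1ℤ ⊛ e₁ ⊕ 1ℤ ⊛ e₂ ⊕ 1ℤ ⊛ e₃) (solve (gyd ∷ gy ∷ gd ∷ g0 ∷ F1 ∷ Kyd ∷ Ky ∷ K0 ∷ []))

    -- The bracketed constant, free of `y` and `z`, becomes the third coordinate of the conjugated
    -- translation; the last term is the twist in the product with a triple whose first coordinate
    -- is `F d`.
    h-shift : ∀ y z d e t → h (y ℤ.+ e) (z ℤ.+ t ℤ.+ ℤ.- (y ℤ.* d)) ≡ₚ
      h y z ℤ.+ (F t ℤ.* G′ 1ℤ ℤ.- f 0ℤ ℤ.* G′ e ℤ.+ F d ℤ.* g 0ℤ) ℤ.+ ℤ.- (g y ℤ.* F d)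
    h-shift y z d e t = lemma (f 0ℤ) (g (y ℤ.+ e)) (g y) (g 0ℤ) (F d) (G′ e) (F t) (G′ 1ℤ)
      (h (y ℤ.+ e) z′) (h y z) (K z′) (K z) (K (z ℤ.+ t))
      (equation 0ℤ (y ℤ.+ e) z′ z′ (≡⇒≡ₚ (lemma₁ (y ℤ.+ e) z′)))
      (equation 0ℤ y z z (≡⇒≡ₚ (lemma₁ y z)))
      (K-increment d y z′ (z ℤ.+ t) (≡⇒≡ₚ (lemma₂ y z d t)))
      (K-increment t 1ℤ z (z ℤ.+ t) (≡⇒≡ₚ (lemma₃ z t)))
      (g-shift y e)
      where
      z′ : ℤ
      z′ = z ℤ.+ t ℤ.+ ℤ.- (y ℤ.* d)
      lemma₁ : ∀ y z → z ≡ z ℤ.+ 0ℤ ℤ.* y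
      lemma₁ y z = solve (y ∷ z ∷ [])
      lemma₂ : ∀ y z d t → z ℤ.+ t ≡ z ℤ.+ t ℤ.+ ℤ.- (y ℤ.* d) ℤ.+ d ℤ.* y
      lemma₂ y z d t = solve (y ∷ z ∷ d ∷ t ∷ [])
      lemma₃ : ∀ z t → z ℤ.+ t ≡ z ℤ.+ t ℤ.* 1ℤ
      lemma₃ z t = solve (z ∷ t ∷ [])
      lemma : ∀ f0 g′ gy g0 Fd Ge Ft G1 h′ hyz Kz′ Kz K+ → h′ ℤ.+ f0 ℤ.* g′ ≡ₚ Kz′ → hyz ℤ.+ f0 ℤ.* gy ≡ₚ Kz →
        K+ ≡ₚ Kz′ ℤ.+ Fd ℤ.* (gy ℤ.- g0) → K+ ≡ₚ Kz ℤ.+ Ft ℤ.* G1 → g′ ≡ₚ gy ℤ.+ Ge →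
        h′ ≡ₚ hyz ℤ.+ (Ft ℤ.* G1 ℤ.- f0 ℤ.* Ge ℤ.+ Fd ℤ.* g0) ℤ.+ ℤ.- (gy ℤ.* Fd)
      lemma f0 g′ gy g0 Fd Ge Ft G1 h′ hyz Kz′ Kz K+ e₁ e₂ e₃ e₄ e₅ =
        combine (1ℤ ⊛ e₁ ⊕ ℤ.- 1ℤ ⊛ e₂ ⊕ ℤ.- 1ℤ ⊛ e₃ ⊕ 1ℤ ⊛ e₄ ⊕ ℤ.- f0 ⊛ e₅)
          (solve (f0 ∷ g′ ∷ gy ∷ g0 ∷ Fd ∷ Ge ∷ Ft ∷ G1 ∷ h′ ∷ hyz ∷ Kz′ ∷ Kz ∷ K+ ∷ []))

  -- Kind-preserving maps in coordinates

  xᵗ yᵗ zᵗ : Triple → ℤ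
  xᵗ (x , _ , _) = x
  yᵗ (_ , y , _) = y
  zᵗ (_ , _ , z) = z

  ≋⇒Line : ∀ k {s t} → s ≋ t → Line k s t
  ≋⇒Line 𝐚 (_ , y≡ , z≡)  = y≡ , z≡
  ≋⇒Line 𝐛 (x≡ , y≡ , z≡) = x≡ , +-congₚ z≡ (*-congₚ x≡ y≡)

  module _ (Φ : Triple → Triple) (Φ-cong : ∀ {s t} → s ≋ t → Φ s ≋ Φ t)
    (Φ-joined : ∀ k {s t} → Joined k s t → Joined k (Φ s) (Φ t)) where

    Line-preserving : ∀ k {s t} → Line k s t → Line k (Φ s) (Φ t)
    Line-preserving k st =
      [ (λ e → ≋⇒Line k (Φ-cong e)) , (λ j → line k (Φ-joined k j)) ]′ (equal-or-joined k st)

    -- Vertices with distinct x are joined along a line of kind 𝐛, an edge of kind 𝐚 and a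
    -- line of kind 𝐛; so are their images, and only the edge of kind 𝐚 changes x.
    x-apart : ∀ s t → ¬ xᵗ s ≡ₚ xᵗ t → ¬ xᵗ (Φ s) ≡ₚ xᵗ (Φ t)
    x-apart s@(x , y , z) t@(x′ , y′ , z′) x≢ e =
      let x≡₁ , _ = Line-preserving 𝐛 {s} {m} (≡⇒≡ₚ ≡.refl , ≡⇒≡ₚ (lemma₁ x y z u))
          x≢₂ , _ = Φ-joined 𝐚 {m} {n} (x≢ , ≡⇒≡ₚ ≡.refl , ≡⇒≡ₚ ≡.refl)
          x≡₃ , _ = Line-preserving 𝐛 {n} {t} (≡⇒≡ₚ ≡.refl , lemma₂ x y z x′ y′ z′ u (proj₂ division))
      in x≢₂ (≡ₚ-trans (≡ₚ-sym x≡₁) (≡ₚ-trans e (≡ₚ-sym x≡₃)))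
      where
      -- Lines with different x meet in one point; `u` is its y-coordinate, and `m` and `n` are the
      -- flags of that point with the two lines.
      division : ∃[ u ] u ℤ.* (x′ ℤ.- x) ≡ₚ z′ ℤ.+ x′ ℤ.* y′ ℤ.- (z ℤ.+ x ℤ.* y)
      division = divideₚ (difference≢0 x≢) _
      u : ℤ
      u = proj₁ division
      m n : Triple
      m = x , u , z ℤ.+ x ℤ.* y ℤ.- x ℤ.* u
      n = x′ , u , z ℤ.+ x ℤ.* y ℤ.- x ℤ.* u
      lemma₁ : ∀ x y z u → z ℤ.+ x ℤ.* y ≡ z ℤ.+ x ℤ.* y ℤ.- x ℤ.* u ℤ.+ x ℤ.* u
      lemma₁ x y z u = solve (x ∷ y ∷ z ∷ u ∷ [])
      lemma₂ : ∀ x y z x′ y′ z′ u → u ℤ.* (x′ ℤ.- x) ≡ₚ z′ ℤ.+ x′ ℤ.* y′ ℤ.- (z ℤ.+ x ℤ.* y) →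
        z ℤ.+ x ℤ.* y ℤ.- x ℤ.* u ℤ.+ x′ ℤ.* u ≡ₚ z′ ℤ.+ x′ ℤ.* y′
      lemma₂ x y z x′ y′ z′ u e = combine (1ℤ ⊛ e) (solve (x ∷ y ∷ z ∷ x′ ∷ y′ ∷ z′ ∷ u ∷ []))

    -- Dually, points with different y lie on a common line: `u` is its x-coordinate, and the edge
    -- of kind `𝐛` between the two flags on it is the only move that changes y.
    y-apart : ∀ s t → ¬ yᵗ s ≡ₚ yᵗ t → ¬ yᵗ (Φ s) ≡ₚ yᵗ (Φ t)
    y-apart s@(x , y , z) t@(x′ , y′ , z′) y≢ e =
      let y≡₁ , _ = Line-preserving 𝐚 {s} {m} (≡⇒≡ₚ ≡.refl , ≡⇒≡ₚ ≡.refl)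
          y≢₂ , _ = Φ-joined 𝐛 {m} {n} (y≢ , ≡⇒≡ₚ ≡.refl , lemma₂ y z y′ z′ u (proj₂ division))
          y≡₃ , _ = Line-preserving 𝐚 {n} {t} (≡⇒≡ₚ ≡.refl , ≡⇒≡ₚ ≡.refl)
      in y≢₂ (≡ₚ-trans (≡ₚ-sym y≡₁) (≡ₚ-trans e (≡ₚ-sym y≡₃)))
      where
      division : ∃[ u ] u ℤ.* (y′ ℤ.- y) ≡ₚ z ℤ.- z′
      division = divideₚ (difference≢0 y≢) _
      u : ℤ
      u = proj₁ division
      m n : Triple
      m = u , y , z
      n = u , y′ , z′
      lemma₂ : ∀ y z y′ z′ u → u ℤ.* (y′ ℤ.- y) ≡ₚ z ℤ.- z′ → z ℤ.+ u ℤ.* y ≡ₚ z′ ℤ.+ u ℤ.* y′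
      lemma₂ y z y′ z′ u e = combine (ℤ.- 1ℤ ⊛ e) (solve (y ∷ z ∷ y′ ∷ z′ ∷ u ∷ []))

  -- Right multiplication in coordinates: `translation (eval g) (eval u)` unfolds to `eval (u ∙ g)`.
  translation : Triple → Triple → Triple
  translation (d , e , t) (x , y , z) = x ℤ.+ d , y ℤ.+ e , z ℤ.+ t ℤ.+ ℤ.- (y ℤ.* d)

  translation-cong : ∀ {s s′ t t′} → s ≋ s′ → t ≋ t′ → translation s t ≋ translation s′ t′
  translation-cong (d , e , r) (x , y , z) =
    +-congₚ x d , +-congₚ y e , +-congₚ (+-congₚ z r) (neg-congₚ (*-congₚ y d))

  module _ (Φ Ψ : Triple → Triple)
    (Φ-cong : ∀ {s t} → s ≋ t → Φ s ≋ Φ t) (Ψ-cong : ∀ {s t} → s ≋ t → Ψ s ≋ Ψ t)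
    (Φ-joined : ∀ k {s t} → Joined k s t → Joined k (Φ s) (Φ t))
    (Ψ-joined : ∀ k {s t} → Joined k s t → Joined k (Ψ s) (Ψ t))
    (ΨΦ≋id : ∀ t → Ψ (Φ t) ≋ t) where

    private
      -- Samples of the coordinates of `Φ`, with the free coordinates set to 0; `xᵗ-Φ`, `yᵗ-Φ` and
      -- `zᵗ-Φ` make this choice immaterial. The value of `k` is the w-coordinate of the image.
      f g : ℤ → ℤ
      f x = xᵗ (Φ (x , 0ℤ , 0ℤ))
      g y = yᵗ (Φ (0ℤ , y , 0ℤ))

      h k : ℤ → ℤ → ℤ
      h y z = zᵗ (Φ (0ℤ , y , z))
      k x w = let s = Φ (x , 0ℤ , w) in zᵗ s ℤ.+ xᵗ s ℤ.* yᵗ s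

    -- The contrapositive of `x-apart` for the inverse map `Ψ`; decidability of the congruence
    -- removes the double negation.
    xᵗ-Φ : ∀ s t → xᵗ s ≡ₚ xᵗ t → xᵗ (Φ s) ≡ₚ xᵗ (Φ t)
    xᵗ-Φ s t e = decidable-stable (_ ≟ₚ _) λ x≢ → x-apart Ψ Ψ-cong Ψ-joined (Φ s) (Φ t) x≢
      (≡ₚ-trans (proj₁ (ΨΦ≋id s)) (≡ₚ-trans e (≡ₚ-sym (proj₁ (ΨΦ≋id t)))))

    yᵗ-Φ : ∀ s t → yᵗ s ≡ₚ yᵗ t → yᵗ (Φ s) ≡ₚ yᵗ (Φ t)
    yᵗ-Φ s t e = decidable-stable (_ ≟ₚ _) λ y≢ → y-apart Ψ Ψ-cong Ψ-joined (Φ s) (Φ t) y≢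
      (≡ₚ-trans (proj₁ (proj₂ (ΨΦ≋id s))) (≡ₚ-trans e (≡ₚ-sym (proj₁ (proj₂ (ΨΦ≋id t))))))

    zᵗ-Φ : ∀ s t → Line 𝐚 s t → zᵗ (Φ s) ≡ₚ zᵗ (Φ t)
    zᵗ-Φ s t e = proj₂ (Line-preserving Φ Φ-cong Φ-joined 𝐚 {s} {t} e)

    -- The w-coordinate of the image of (x , y , z) is computed from its own coordinates and again
    -- at (x , 0 , w), on the same line of kind `𝐛`.
    equation : ∀ x y z w → w ≡ₚ z ℤ.+ x ℤ.* y → h y z ℤ.+ f x ℤ.* g y ≡ₚ k x w
    equation x y z w w≡ = ≡ₚ-trans
      (+-congₚ (zᵗ-Φ (0ℤ , y , z) (x , y , z) (≡⇒≡ₚ ≡.refl , ≡⇒≡ₚ ≡.refl))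
        (*-congₚ (xᵗ-Φ (x , 0ℤ , 0ℤ) (x , y , z) (≡⇒≡ₚ ≡.refl))
          (yᵗ-Φ (0ℤ , y , 0ℤ) (x , y , z) (≡⇒≡ₚ ≡.refl))))
      (proj₂ (Line-preserving Φ Φ-cong Φ-joined 𝐛 {x , y , z} {x , 0ℤ , w}
        (≡⇒≡ₚ ≡.refl , ≡ₚ-trans (≡ₚ-sym w≡) (≡⇒≡ₚ (lemma x w)))))
      where
      lemma : ∀ x w → w ≡ w ℤ.+ x ℤ.* 0ℤ
      lemma x w = solve (x ∷ w ∷ [])

    open FunctionalEquation f g h k equation
      (x-apart Φ Φ-cong Φ-joined (1ℤ , 0ℤ , 0ℤ) (0ℤ , 0ℤ , 0ℤ) 1≢0)
      (y-apart Φ Φ-cong Φ-joined (0ℤ , 1ℤ , 0ℤ) (0ℤ , 0ℤ , 0ℤ) 1≢0)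

    normalizes-translation : ∀ s → ∃[ s′ ] (∀ t → Φ (translation s t) ≋ translation s′ (Φ t))
    normalizes-translation (d , e , r) = s′ , λ t → x-image t , y-image t , z-image t
      where
      s′ : Triple
      s′ = F d , G′ e , F r ℤ.* G′ 1ℤ ℤ.- f 0ℤ ℤ.* G′ e ℤ.+ F d ℤ.* g 0ℤ
      r≡r : ∀ {x} → x ≡ₚ x
      r≡r = ≡⇒≡ₚ ≡.refl
      x-image : ∀ t → xᵗ (Φ (translation (d , e , r) t)) ≡ₚ xᵗ (translation s′ (Φ t))
      x-image t@(x , y , z) = ≡ₚ-trans (xᵗ-Φ (translation (d , e , r) t) (x ℤ.+ d , 0ℤ , 0ℤ) r≡r)
        (≡ₚ-trans (f-shift x d) (+-congₚ (xᵗ-Φ (x , 0ℤ , 0ℤ) t r≡r) r≡r))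
      y-image : ∀ t → yᵗ (Φ (translation (d , e , r) t)) ≡ₚ yᵗ (translation s′ (Φ t))
      y-image t@(x , y , z) = ≡ₚ-trans (yᵗ-Φ (translation (d , e , r) t) (0ℤ , y ℤ.+ e , 0ℤ) r≡r)
        (≡ₚ-trans (g-shift y e) (+-congₚ (yᵗ-Φ (0ℤ , y , 0ℤ) t r≡r) r≡r))
      z-image : ∀ t → zᵗ (Φ (translation (d , e , r) t)) ≡ₚ zᵗ (translation s′ (Φ t))
      z-image t@(x , y , z) = ≡ₚ-trans
        (zᵗ-Φ (translation (d , e , r) t) (0ℤ , y ℤ.+ e , z ℤ.+ r ℤ.+ ℤ.- (y ℤ.* d)) (r≡r , r≡r))
        (≡ₚ-trans (h-shift y z d e r)
          (+-congₚ (+-congₚ (zᵗ-Φ (0ℤ , y , z) t (r≡r , r≡r)) r≡r)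
            (neg-congₚ (*-congₚ (yᵗ-Φ (0ℤ , y , 0ℤ) t r≡r) r≡r))))

  -- Conjugation of right translations

  Normalizes : Automorphism Γ → Set
  Normalizes φ = ∀ g → ∃[ g′ ] (∀ u → to φ (u ∙ g) ≈ to φ u ∙ g′)

  preserving⇒normalizes : ∀ φ → KindPreserving φ → Normalizes φ
  preserving⇒normalizes φ preserves g =
    let s′ , image = normalizes-translation (onTriples φ) (onTriples (φ ⁻¹ᵃ))
          (onTriples-cong φ) (onTriples-cong (φ ⁻¹ᵃ)) (onTriples-joined φ preserves)
          (onTriples-joined (φ ⁻¹ᵃ) (KindPreserving-⁻¹ φ preserves)) ΨΦ≋id (eval g)
    in word-of s′ , λ u → eval-injective (≋.begin
         eval (to φ (u ∙ g))                                   ≋.≈⟨ onTriples-eval φ (u ∙ g) ⟩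
         onTriples φ (translation (eval g) (eval u))           ≋.≈⟨ image (eval u) ⟩
         translation s′ (onTriples φ (eval u))                 ≋.≈⟨ translation-cong {eval (word-of s′)} {s′}
                                                                  {eval (to φ u)} {onTriples φ (eval u)}
                                                                  (eval-word-of s′) (onTriples-eval φ u) ⟨
         translation (eval (word-of s′)) (eval (to φ u))       ≋.∎)
    where
    onTriples : Automorphism Γ → Triple → Triple
    onTriples ψ t = eval (to ψ (word-of t))
    onTriples-cong : ∀ ψ {s t} → s ≋ t → onTriples ψ s ≋ onTriples ψ t
    onTriples-cong ψ {s} {t} s≋t = eval-cong (to-cong ψ (eval-injective (≋.begin
      eval (word-of s)  ≋.≈⟨ eval-word-of s ⟩
      s                 ≋.≈⟨ s≋t ⟩
      t                 ≋.≈⟨ eval-word-of t ⟨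
      eval (word-of t)  ≋.∎)))
    onTriples-joined : ∀ ψ → KindPreserving ψ → ∀ k {s t} → Joined k s t →
      Joined k (onTriples ψ s) (onTriples ψ t)
    onTriples-joined ψ preserves k {s} {t} j = preserves k {word-of s} {word-of t}
      (Joined-resp k _ _ _ _ (Setoid.sym ≋-setoid {eval (word-of s)} (eval-word-of s))
        (Setoid.sym ≋-setoid {eval (word-of t)} (eval-word-of t)) j)
    word-of-eval : ∀ u → word-of (eval u) ≈ u
    word-of-eval u = eval-injective (eval-word-of (eval u))
    onTriples-eval : ∀ ψ u → eval (to ψ u) ≋ onTriples ψ (eval u)
    onTriples-eval ψ u = eval-cong (to-cong ψ (sym (word-of-eval u)))
    ΨΦ≋id : ∀ t → onTriples (φ ⁻¹ᵃ) (onTriples φ t) ≋ t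
    ΨΦ≋id t = ≋.begin
      eval (from φ (word-of (onTriples φ t)))  ≋.≈⟨ eval-cong (from-cong φ (word-of-eval (to φ (word-of t)))) ⟩
      eval (from φ (to φ (word-of t)))         ≋.≈⟨ eval-cong (strictlyInverseʳ φ (word-of t)) ⟩
      eval (word-of t)                         ≋.≈⟨ eval-word-of t ⟩
      t                                        ≋.∎

  -- Hence the swap conjugates right translation by g to right translation by `to swap g`, which
  -- settles automorphisms that exchange the kinds.
  swap-homomorphic : ∀ u v → to swap (u ∙ v) ≈ to swap u ∙ to swap v
  swap-homomorphic u v = eval-injective (≋.begin
    eval (to swap (u ∙ v))                                    ≋.≈⟨ eval-word-of _ ⟩
    map (translation (eval v) (eval u))                       ≋.≈⟨ ≡⇒≡ₚ ≡.refl , ≡⇒≡ₚ ≡.refl ,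
                                                                   ≡⇒≡ₚ (lemma (X u) (Y u) (Z u) (X v) (Y v) (Z v)) ⟩
    translation (map (eval v)) (map (eval u))                 ≋.≈⟨ translation-cong
                                                                     {eval (to swap v)} {map (eval v)}
                                                                     {eval (to swap u)} {map (eval u)}
                                                                     (eval-word-of _) (eval-word-of _) ⟨
    eval (to swap u ∙ to swap v)                              ≋.∎)
    where
    open JoinedMap swapᵗ using (map)
    lemma : ∀ x y z x′ y′ z′ →
      ℤ.- (z ℤ.+ z′ ℤ.+ ℤ.- (y ℤ.* x′) ℤ.+ (x ℤ.+ x′) ℤ.* (y ℤ.+ y′)) ≡
      ℤ.- (z ℤ.+ x ℤ.* y) ℤ.+ ℤ.- (z′ ℤ.+ x′ ℤ.* y′) ℤ.+ ℤ.- (x ℤ.* y′)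
    lemma x y z x′ y′ z′ = solve (x ∷ y ∷ z ∷ x′ ∷ y′ ∷ z′ ∷ [])

  normalizes : ∀ φ → Normalizes φ
  normalizes φ = [ preserving⇒normalizes φ , swapping ]′ (preserving-or-swapping φ)
    where
    swapping : KindPreserving (φ then swap) → Normalizes φ
    swapping preserves g =
      let g′ , image = preserving⇒normalizes (φ then swap) preserves g
      in to swap g′ , λ u → ≈.begin
        to φ (u ∙ g)                             ≈.≈⟨ strictlyInverseʳ swap (to φ (u ∙ g)) ⟨
        to swap (to swap (to φ (u ∙ g)))         ≈.≈⟨ to-cong swap (image u) ⟩
        to swap (to swap (to φ u) ∙ g′)          ≈.≈⟨ swap-homomorphic (to swap (to φ u)) g′ ⟩
        to swap (to swap (to φ u)) ∙ to swap g′  ≈.≈⟨ ∙-cong (strictlyInverseʳ swap (to φ u)) refl ⟩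
        to φ u ∙ to swap g′                      ≈.∎

  normal-Cayley : IsNormalCayley G connectionSet
  normal-Cayley = record
    { resp      = λ φ≈ψ (g , e) → g , λ v → trans (sym (φ≈ψ v)) (e v)
    ; ε∈        = ε , λ v → sym (identityʳ v)
    ; ∙-closed  = λ (g , e) (h , e′) → g ∙ h , λ v →
        trans (e′ _) (trans (∙-cong (e v) refl) (assoc v g h))
    ; ⁻¹-closed = λ {φ} (g , e) → g ⁻¹ , λ v → ≈.begin
        from φ v                 ≈.≈⟨ from-cong φ (trans (assoc v (g ⁻¹) g) (trans (∙-cong refl (inverseˡ g)) (identityʳ v))) ⟨
        from φ (v ∙ g ⁻¹ ∙ g)    ≈.≈⟨ from-cong φ (e (v ∙ g ⁻¹)) ⟨
        from φ (to φ (v ∙ g ⁻¹)) ≈.≈⟨ strictlyInverseʳ φ (v ∙ g ⁻¹) ⟩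
        v ∙ g ⁻¹                 ≈.∎
    ; normal    = λ φ {ρ} (g , e) →
        let g′ , image = normalizes φ g
        in g′ , λ v → ≈.begin
          to φ (to ρ (from φ v))   ≈.≈⟨ to-cong φ (e (from φ v)) ⟩
          to φ (from φ v ∙ g)      ≈.≈⟨ image (from φ v) ⟩
          to φ (from φ v) ∙ g′     ≈.≈⟨ ∙-cong (strictlyInverseˡ φ v) refl ⟩
          v ∙ g′                   ≈.∎
    }

  -- Vertices at distance 3, and 2-arcs

  adj-to : ∀ φ {u v} → Adj u v → Adj (to φ u) (to φ v)
  adj-to φ {u} {v} = Equivalence.to (Adj-⇔ φ {u} {v})

  -- Both z and w vanish at ε and at its neighbours; one further edge keeps z or keeps w.
  Flat : Triple → Set
  Flat (x , y , z) = z ≡ₚ 0ℤ × z ℤ.+ x ℤ.* y ≡ₚ 0ℤ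

  origin : Triple
  origin = 0ℤ , 0ℤ , 0ℤ

  joined-origin⇒flat : ∀ k {t} → Joined k origin t → Flat t
  joined-origin⇒flat 𝐚 {x , y , z} (_ , y≡ , z≡) = ≡ₚ-sym z≡ ,
    combine (ℤ.- 1ℤ ⊛ z≡ ⊕ ℤ.- x ⊛ y≡) (solve (x ∷ y ∷ z ∷ []))
  joined-origin⇒flat 𝐛 {x , y , z} (_ , x≡ , w≡) =
    combine (ℤ.- 1ℤ ⊛ w≡ ⊕ y ⊛ x≡) (solve (x ∷ y ∷ z ∷ [])) ,
    combine (ℤ.- 1ℤ ⊛ w≡) (solve (x ∷ y ∷ z ∷ []))

  joined-flat : ∀ k {s t} → Flat s → Joined k s t →
    proj₂ (proj₂ t) ≡ₚ 0ℤ ⊎ proj₂ (proj₂ t) ℤ.+ proj₁ t ℤ.* proj₁ (proj₂ t) ≡ₚ 0ℤ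
  joined-flat 𝐚 (z≡0 , _) (_ , _ , z≡) = inj₁ (≡ₚ-trans (≡ₚ-sym z≡) z≡0)
  joined-flat 𝐛 (_ , w≡0) (_ , _ , w≡) = inj₂ (≡ₚ-trans (≡ₚ-sym w≡) w≡0)

  Flat-resp : ∀ {u v} → Flat (eval u) → u ≈ v → Flat (eval v)
  Flat-resp (z≡0 , w≡0) u≈v = let x , y , z = eval-cong u≈v in
    ≡ₚ-trans (≡ₚ-sym z) z≡0 , ≡ₚ-trans (≡ₚ-sym (+-congₚ z (*-congₚ x y))) w≡0

  -- Within distance two of ε at least one of z and w vanishes, so a vertex where neither does is at
  -- distance at least 3.
  distance-3 : ∀ {g} → ¬ Z g ≡ₚ 0ℤ → ¬ Z g ℤ.+ X g ℤ.* Y g ≡ₚ 0ℤ → Walk Γ ε g 3 → IsDistance Γ ε g 3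
  distance-3 {g} z≢0 w≢0 walk = walk , least
    where
    not-flat : ¬ Flat (eval g)
    not-flat (z≡0 , _) = z≢0 z≡0
    least : ∀ {n} → Walk Γ ε g n → 3 ℕ.≤ n
    least (here ε≈g) = contradiction (Flat-resp (≡⇒≡ₚ ≡.refl , ≡⇒≡ₚ ≡.refl) ε≈g) not-flat
    least (step {v = u} εu (here u≈g)) =
      let k , j = adjacent⇒joined {ε} {u} εu
      in contradiction (Flat-resp (joined-origin⇒flat k j) u≈g) not-flat
    least (step {v = u} εu (step {v = v} uv (here v≈g))) =
      let k , j  = adjacent⇒joined {ε} {u} εu
          l , j′ = adjacent⇒joined {u} {v} uv
          j″     = Joined-resp l (eval u) (eval u) (eval v) (eval g) (≡⇒≋ ≡.refl) (eval-cong v≈g) j′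
      in [ (λ z≡0 → contradiction z≡0 z≢0) , (λ w≡0 → contradiction w≡0 w≢0) ]′
           (joined-flat l (joined-origin⇒flat k j) j″)
    least (step _ (step _ (step _ _))) = ℕ.s≤s (ℕ.s≤s (ℕ.s≤s ℕ.z≤n))

  same-distance : ∀ {u v x y n} → IsDistance Γ u v n → IsDistance Γ x y n → SameDistance Γ u v x y
  same-distance {n = n} d e m = mk⇔ (λ d′ → ≡.subst (IsDistance Γ _ _) (unique d d′) e)
                                    (λ e′ → ≡.subst (IsDistance Γ _ _) (unique e e′) d)
    where
    unique : ∀ {u v m n} → IsDistance Γ u v m → IsDistance Γ u v n → m ≡ n
    unique (walk , least) (walk′ , least′) = ℕₚ.≤-antisym (least walk′) (least′ walk)

  -- The target is a b a⁻¹, with x = 0 and y = z = w = 1. Edges of kind `𝐚` keep y and z, those of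
  -- kind `𝐛` keep x and w; this excludes every order of kinds but `𝐚 𝐛 𝐚`, for which w = 0 and y =
  -- z = 1 at `n` force x = - 1.
  unique-geodesic : ∀ k l o {m n} → Joined k origin m → Joined l m n → Joined o n (0ℤ , 1ℤ , 1ℤ) →
    m ≋ (ℤ.-1ℤ , 0ℤ , 0ℤ)
  unique-geodesic 𝐚 𝐚 𝐚 {m = x , y , z} {x′ , y′ , z′} (_ , 0≡y , _) (_ , y≡y′ , _) (_ , y′≡1 , _) =
    contradiction (combine (ℤ.- 1ℤ ⊛ y′≡1 ⊕ ℤ.- 1ℤ ⊛ y≡y′ ⊕ ℤ.- 1ℤ ⊛ 0≡y) (solve (y ∷ y′ ∷ []))) 1≢0
  unique-geodesic 𝐚 𝐚 𝐛 {m = x , y , z} {x′ , y′ , z′} (_ , 0≡y , 0≡z) (_ , y≡y′ , z≡z′) (_ , x′≡0 , w′≡1) =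
    contradiction (combine (ℤ.- 1ℤ ⊛ w′≡1 ⊕ y′ ⊛ x′≡0 ⊕ ℤ.- 1ℤ ⊛ 0≡z ⊕ ℤ.- 1ℤ ⊛ z≡z′)
      (solve (x′ ∷ y′ ∷ z ∷ z′ ∷ []))) 1≢0
  unique-geodesic 𝐚 𝐛 𝐚 {m = x , y , z} {x′ , y′ , z′} (_ , 0≡y , 0≡z) (_ , x≡x′ , w≡w′) (_ , y′≡1 , z′≡1) =
    combine (ℤ.- 1ℤ ⊛ w≡w′ ⊕ ℤ.- 1ℤ ⊛ 0≡z ⊕ ℤ.- x ⊛ 0≡y ⊕ ℤ.- 1ℤ ⊛ z′≡1 ⊕ ℤ.- x′ ⊛ y′≡1 ⊕ 1ℤ ⊛ x≡x′)
      (solve (x ∷ y ∷ z ∷ x′ ∷ y′ ∷ z′ ∷ [])) ,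
    ≡ₚ-sym 0≡y , ≡ₚ-sym 0≡z
  unique-geodesic 𝐚 𝐛 𝐛 (0≢x , _) (_ , x≡x′ , _) (_ , x′≡0 , _) =
    contradiction (≡ₚ-sym (≡ₚ-trans x≡x′ x′≡0)) 0≢x
  unique-geodesic 𝐛 𝐚 𝐚 {m = x , y , z} {x′ , y′ , z′} (_ , 0≡x , 0≡w) (_ , _ , z≡z′) (_ , _ , z′≡1) =
    contradiction (combine (ℤ.- 1ℤ ⊛ z′≡1 ⊕ ℤ.- 1ℤ ⊛ z≡z′ ⊕ ℤ.- 1ℤ ⊛ 0≡w ⊕ y ⊛ 0≡x)
      (solve (x ∷ y ∷ z ∷ z′ ∷ []))) 1≢0
  unique-geodesic 𝐛 𝐚 𝐛 (_ , 0≡x , _) (x≢x′ , _) (_ , x′≡0 , _) =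
    contradiction (≡ₚ-trans (≡ₚ-sym 0≡x) (≡ₚ-sym x′≡0)) x≢x′
  unique-geodesic 𝐛 𝐛 𝐚 {m = x , y , z} {x′ , y′ , z′} (_ , 0≡x , 0≡w) (_ , x≡x′ , w≡w′) (_ , _ , z′≡1) =
    contradiction (combine (ℤ.- 1ℤ ⊛ z′≡1 ⊕ ℤ.- 1ℤ ⊛ w≡w′ ⊕ ℤ.- 1ℤ ⊛ 0≡w ⊕ y′ ⊛ 0≡x ⊕ y′ ⊛ x≡x′)
      (solve (x ∷ y ∷ z ∷ x′ ∷ y′ ∷ z′ ∷ []))) 1≢0
  unique-geodesic 𝐛 𝐛 𝐛 {m = x , y , z} {x′ , y′ , z′} (_ , _ , 0≡w) (_ , _ , w≡w′) (_ , _ , w′≡1) =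
    contradiction (combine (ℤ.- 1ℤ ⊛ w′≡1 ⊕ ℤ.- 1ℤ ⊛ w≡w′ ⊕ ℤ.- 1ℤ ⊛ 0≡w)
      (solve (x ∷ y ∷ z ∷ x′ ∷ y′ ∷ z′ ∷ []))) 1≢0

  module _ (p-odd : ¬ 2 ∣ p) where

    2<p : 2 ℕ.< p
    2<p = ℕₚ.≤∧≢⇒< (ℕ.nonTrivial⇒n>1 p {{prime⇒nonTrivial p-prime}})
      (λ 2≡p → p-odd (≡.subst (2 ∣_) 2≡p ∣-refl))

    2≢0 : ¬ + 2 ≡ₚ 0ℤ
    2≢0 e with () ← ≡ₚ⇒≡ 2<p (ℕ.>-nonZero⁻¹ p) e

    0≢2 : ¬ 0ℤ ≡ₚ + 2
    0≢2 e = 2≢0 (≡ₚ-sym e)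

    0≢1 : ¬ 0ℤ ≡ₚ 1ℤ
    0≢1 e = 1≢0 (≡ₚ-sym e)

    1≢2 : ¬ 1ℤ ≡ₚ + 2
    1≢2 e = 1≢0 (combine (ℤ.- 1ℤ ⊛ e) ≡.refl)

    -- The ends of the arc ε, a, a a are adjacent, those of ε, a, b a are not. As p is odd, a a
    -- differs from ε and the first sequence is an arc.
    not-2-arc-transitive : ¬ s-ArcTransitive Γ 2
    not-2-arc-transitive (_ , transitive) =
      let φ , images = transitive straight bent straight-isArc bent-isArc
          k , j = adjacent⇒joined {ε} {b ∙ a} (proj₁ (Graph.Adj-resp-≈ Γ) {ε} (images 2F)
            (proj₂ (Graph.Adj-resp-≈ Γ) {_} (images 0F) (adj-to φ {ε} {a ∙ a} ε-aa)))
      in no-edge k j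
      where
      straight bent : Vector (Word Generator) 3
      straight = ε Vector.∷ a Vector.∷ a ∙ a Vector.∷ Vector.[]
      bent = ε Vector.∷ a Vector.∷ b ∙ a Vector.∷ Vector.[]
      ε-a : Adj ε a
      ε-a = joined⇒adjacent 𝐚 {ε} {a} (0≢1 , 0≡ₚ0 , 0≡ₚ0)
      a-aa : Adj a (a ∙ a)
      a-aa = joined⇒adjacent 𝐚 {a} {a ∙ a} (1≢2 , 0≡ₚ0 , 0≡ₚ0)
      ε-aa : Adj ε (a ∙ a)
      ε-aa = joined⇒adjacent 𝐚 {ε} {a ∙ a} (0≢2 , 0≡ₚ0 , 0≡ₚ0)
      a-ba : Adj a (b ∙ a)
      a-ba = joined⇒adjacent 𝐛 {a} {b ∙ a} (0≢1 , ≡⇒≡ₚ ≡.refl , ≡⇒≡ₚ ≡.refl)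
      no-edge : ∀ k → ¬ Joined k (eval ε) (eval (b ∙ a))
      no-edge 𝐚 (_ , y≡ , _) = 0≢1 y≡
      no-edge 𝐛 (_ , x≡ , _) = 0≢1 x≡
      straight-isArc : IsArc Γ 2 straight
      straight-isArc = record
        { adjacent = λ
          { 0F 1F _ → ε-a ; 1F 2F _ → a-aa
          ; 0F 0F () ; 0F 2F () ; 1F 0F () ; 1F 1F () ; 2F 0F () ; 2F 1F () ; 2F 2F () }
        ; nonBacktracks = λ
          { 0F 2F _ e → 0≢2 (proj₁ (eval-cong e))
          ; 0F 0F () ; 0F 1F () ; 1F 0F () ; 1F 1F () ; 1F 2F () ; 2F 0F () ; 2F 1F () ; 2F 2F () }
        }
      bent-isArc : IsArc Γ 2 bent
      bent-isArc = record
        { adjacent = λ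
          { 0F 1F _ → ε-a ; 1F 2F _ → a-ba
          ; 0F 0F () ; 0F 2F () ; 1F 0F () ; 1F 1F () ; 2F 0F () ; 2F 1F () ; 2F 2F () }
        ; nonBacktracks = λ
          { 0F 2F _ e → 0≢1 (proj₁ (eval-cong e))
          ; 0F 0F () ; 0F 1F () ; 1F 0F () ; 1F 1F () ; 1F 2F () ; 2F 0F () ; 2F 1F () ; 2F 2F () }
        }

    -- The edge sequence a, b, a is the only geodesic from ε to a b a⁻¹, whereas a b c
    -- is reached both by a, b, a and by b, a, b.
    not-distance-transitive : ¬ DistanceTransitive Γ
    not-distance-transitive transitive =
      let φ , ε↦ε , t↦s = transitive ε t ε s (same-distance t-distance s-distance)
          -- The first vertices a⁻¹ and b b of the two geodesics to `t` both go to (- 1 , 0 , 0);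
          -- injectivity then equates their x-coordinates - 1 and 0.
          u↦ = image φ ε↦ε t↦s {a ⁻¹} {b ∙ a ⁻¹} ε-a⁻¹ a⁻¹-ba⁻¹ ba⁻¹-t
          v↦ = image φ ε↦ε t↦s {b ∙ b} {a ∙ (b ∙ b)} ε-bb bb-abb abb-t
          u≈v = eval-injective {to φ (a ⁻¹)} {to φ (b ∙ b)}
            (Setoid.trans ≋-setoid {eval (to φ (a ⁻¹))} {ℤ.-1ℤ , 0ℤ , 0ℤ} {eval (to φ (b ∙ b))} u↦
              (Setoid.sym ≋-setoid {eval (to φ (b ∙ b))} v↦))
          x , _ = eval-cong (trans (sym (strictlyInverseʳ φ (a ⁻¹))) (trans (from-cong φ u≈v) (strictlyInverseʳ φ (b ∙ b))))
      in 0≢1 (combine (1ℤ ⊛ x) ≡.refl)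
      where
      s t : Word Generator
      s = a ∙ b ∙ a ⁻¹
      t = a ∙ b ∙ c
      ε-a⁻¹ : Adj ε (a ⁻¹)
      ε-a⁻¹ = joined⇒adjacent 𝐚 {ε} {a ⁻¹} ((λ e → 1≢0 (combine (1ℤ ⊛ e) ≡.refl)) , 0≡ₚ0 , 0≡ₚ0)
      a⁻¹-ba⁻¹ : Adj (a ⁻¹) (b ∙ a ⁻¹)
      a⁻¹-ba⁻¹ = joined⇒adjacent 𝐛 {a ⁻¹} {b ∙ a ⁻¹} (0≢1 , ≡⇒≡ₚ ≡.refl , ≡⇒≡ₚ ≡.refl)
      ba⁻¹-t : Adj (b ∙ a ⁻¹) t
      ba⁻¹-t = joined⇒adjacent 𝐚 {b ∙ a ⁻¹} {t}
        ((λ e → 0≢2 (combine (1ℤ ⊛ e) ≡.refl)) , ≡⇒≡ₚ ≡.refl , ≡⇒≡ₚ ≡.refl)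
      ε-bb : Adj ε (b ∙ b)
      ε-bb = joined⇒adjacent 𝐛 {ε} {b ∙ b} (0≢2 , 0≡ₚ0 , 0≡ₚ0)
      bb-abb : Adj (b ∙ b) (a ∙ (b ∙ b))
      bb-abb = joined⇒adjacent 𝐚 {b ∙ b} {a ∙ (b ∙ b)} (0≢1 , ≡⇒≡ₚ ≡.refl , ≡⇒≡ₚ ≡.refl)
      abb-t : Adj (a ∙ (b ∙ b)) t
      abb-t = joined⇒adjacent 𝐛 {a ∙ (b ∙ b)} {t}
        ((λ e → 1≢2 (≡ₚ-sym e)) , ≡⇒≡ₚ ≡.refl , ≡⇒≡ₚ ≡.refl)
      ba⁻¹-s : Adj (b ∙ a ⁻¹) s
      ba⁻¹-s = joined⇒adjacent 𝐚 {b ∙ a ⁻¹} {s}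
        ((λ e → 0≢1 (combine (1ℤ ⊛ e) ≡.refl)) , ≡⇒≡ₚ ≡.refl , ≡⇒≡ₚ ≡.refl)
      s-distance : IsDistance Γ ε s 3
      s-distance = distance-3 {s} 1≢0 1≢0
        (step {v = a ⁻¹} ε-a⁻¹ (step {v = b ∙ a ⁻¹} a⁻¹-ba⁻¹ (step {v = s} ba⁻¹-s (here refl))))
      t-distance : IsDistance Γ ε t 3
      -- At `t` the coordinate w is 1 + 1 · 1 = 2, nonzero because p is odd.
      t-distance = distance-3 {t} 1≢0 2≢0
        (step {v = a ⁻¹} ε-a⁻¹ (step {v = b ∙ a ⁻¹} a⁻¹-ba⁻¹ (step {v = t} ba⁻¹-t (here refl))))
      image : ∀ φ → to φ ε ≈ ε → to φ t ≈ s → ∀ {u v} → Adj ε u → Adj u v → Adj v t →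
        eval (to φ u) ≋ (ℤ.-1ℤ , 0ℤ , 0ℤ)
      image φ ε↦ε t↦s {u} {v} εu uv vt =
        let k , j   = adjacent⇒joined {ε} {to φ u}
              (proj₂ (Graph.Adj-resp-≈ Γ) {to φ u} ε↦ε (adj-to φ {ε} {u} εu))
            l , j′  = adjacent⇒joined {to φ u} {to φ v} (adj-to φ {u} {v} uv)
            m , j″  = adjacent⇒joined {to φ v} {s}
              (proj₁ (Graph.Adj-resp-≈ Γ) {to φ v} t↦s (adj-to φ {v} {t} vt))
        in unique-geodesic k l m {eval (to φ u)} {eval (to φ v)} j j′ j″

theorem1p2 : (p : ℕ) (p-prime : Prime p) (p-odd : ¬ (2 ∣ p)) →
    let open Heisenberg p {{prime⇒nonZero p-prime}}
        Γ = Cay G connectionSet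
    in t-DistanceTransitive Γ 2 × IsNormalCayley G connectionSet × ¬ DistanceTransitive Γ × ¬ s-ArcTransitive Γ 2
theorem1p2 p p-prime p-odd =
  2-distance-transitive p p-prime ,
  normal-Cayley p p-prime ,
  not-distance-transitive p p-prime p-odd ,
  not-2-arc-transitive p p-prime p-odd
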